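{- $\mathrm{OSAFGMC}\le\mathrm{WMTL}$ over finitely-branching Kripke trees; that is, for every finite set $AP$ and every sentence $\vartheta$ over $AP$ of the alternation-free one-step fragment of the graded $\mu$-calculus, there is a WMTL sentence over $AP$ satisfied by exactly the same finitely-branching Kripke trees over $AP$ as $\vartheta$.
   Context: Trees. A tree $T$ is a subset of $\mathbb{N}^*$ (finite words over the naturals) with an element $\tau_0\in T$ (the root) such that every $\tau\in T$ has the form $\tau_0\cdot\tau'$ with $\tau'\in\mathbb{N}^*$, and whenever $\tau_0\cdot\tau\in T$ and $\tau'$ is a prefix of $\tau$, also $\tau_0\cdot\tau'\in T$. Elements of $T$ are nodes. A child of $\tau$ in $T$ is a node of $T$ of the form $\tau\cdot n$, $n\in\mathbb{N}$; a descendant of $\tau$ in $T$ is a node of $T$ of the form $\tau\cdot\tau'$, $\tau'\in\mathbb{N}^*$ (so $\tau$ is a descendant of itself). A subtree of $T$ is a subset of $T$ that is a tree (with any root). $T$ is non-blocking if every node has a child in $T$, and finitely-branching if every node has finitely many children in $T$. For a finite set $AP$ of atomic propositions, a Kripke tree over $AP$ is a pair $(T,\mathrm{Lab})$ with $T$ a non-blocking tree and $\mathrm{Lab}:T\to 2^{AP}$; it is finitely-branching if $T$ is. WMTL (weak monadic tree logic). Formulas over $AP$: $\varphi ::= P_a(x)\mid x\le y\mid x\in X\mid \neg\varphi\mid\varphi\wedge\varphi\mid\exists x.\varphi\mid\exists^{\mathrm{t}}X.\varphi$, with $a\in AP$. First-order variables range over nodes of $T$, second-order variables over finite subtrees of $T$;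 $P_a(x)$ holds iff $a\in\mathrm{Lab}(x)$; $x\le y$ holds iff $y$ is a descendant of $x$; $x\in X$ is membership. Sentences are formulas without free variables. OSGMC (one-step fragment of the graded $\mu$-calculus). Let $\mathrm{Var}$ be a set of fixpoint variables. For $Z,O\subseteq\mathrm{Var}$, base formulas $\varphi_{Z,O}$ and fixpoint formulas $\vartheta_{Z,O}$ are given by $\varphi_{Z,O} ::= \bot\mid\top\mid a\mid\neg\varphi_{Z,O}\mid\varphi_{Z,O}\wedge\varphi_{Z,O}\mid\varphi_{Z,O}\vee\varphi_{Z,O}\mid\Diamond^{\ge k}\varphi_{O,\emptyset}\mid\Box^{<k}\varphi_{O,\emptyset}\mid X\mid\vartheta_{\emptyset,\emptyset}$ (with $a\in AP$, $k\in\mathbb{N}$, $X\in Z$), and $\vartheta_{Z,O} ::= \mu X.\vartheta_{Z\cup\{X\},O\cup\{X\}}\mid\nu X.\vartheta_{Z\cup\{X\},O\cup\{X\}}\mid\varphi_{Z,O}$ (with $X\in\mathrm{Var}$), where every occurrence of a variable must be positive (under an even number of negations). Sentences are the formulas of the form $\vartheta_{\emptyset,\emptyset}$. OSAFGMC is the alternation-free fragment of OSGMC: no alternation of fixpoint operators, i.e., in positive normal form no subformula $\mu X.\alpha$ has a subformula $\nu Y.\beta$ of $\alpha$ in which this $X$ occurs free, and dually with $\mu$ and $\nu$ exchanged. Given a Kripke tree $\mathcal{T}=(T,\mathrm{Lab})$ and an assignment $\chi$ of subsets of $T$ to variables, the denotation $[\![\vartheta]\!]^{\mathcal T}_{\chi}\subseteq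 T$ is standard: $[\![a]\!]=\{w: a\in\mathrm{Lab}(w)\}$, $[\![X]\!]_\chi=\chi(X)$, Boolean connectives as set operations, $[\![\Diamond^{\ge k}\varphi]\!]_\chi=\{w\in T: |\mathrm{post}(w)\cap[\![\varphi]\!]_\chi|\ge k\}$, $[\![\Box^{<k}\varphi]\!]_\chi=\{w\in T:|\mathrm{post}(w)\setminus[\![\varphi]\!]_\chi|<k\}$ with $\mathrm{post}(w)$ the set of children of $w$, $[\![\mu X.\vartheta]\!]_\chi=\bigcap\{W\subseteq T:[\![\vartheta]\!]_{\chi[X\mapsto W]}\subseteq W\}$, $[\![\nu X.\vartheta]\!]_\chi=\bigcup\{W\subseteq T: W\subseteq[\![\vartheta]\!]_{\chi[X\mapsto W]}\}$. A Kripke tree satisfies a sentence if its root belongs to the denotation of the sentence. -}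

module Defs where

open import Level using (Level; 0ℓ; Lift) renaming (suc to lsuc)
open import Data.Empty.Polymorphic using (⊥)
open import Data.Unit.Polymorphic using (⊤)
open import Data.Nat.Base using (ℕ; zero; suc)
open import Data.Nat.Properties using (_≟_)
open import Data.Fin.Base using (Fin)
open import Data.Fin.Subset using (Subset) renaming (_∈_ to _∈ˢ_)
open import Data.List.Base using (List; []; _∷_; _++_; _∷ʳ_)
open import Data.List.Membership.Propositional using () renaming (_∈_ to _∈ˡ_)
open import Data.List.Relation.Binary.Prefix.Heterogeneous using (Prefix)
open import Data.Vec.Functional using (Vector) renaming (_∷_ to _▹_; [] to ⟨⟩)
open import Data.Refinement.Base using (Refinement-syntax; value; _,_)
open import Data.Irrelevant using ([_])
open import Data.Product.Base using (∃; _×_)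
open import Data.Sign.Base using (Sign; +; -; opposite; _*_)
open import Data.Sum.Base using (_⊎_)
open import Function.Bundles using (_↣_; Injection)
open import Relation.Binary.Construct.Closure.ReflexiveTransitive using (Star)
open import Relation.Binary.PropositionalEquality using (_≡_)
open import Relation.Nullary using (¬_; yes; no)
open import Relation.Unary using (Pred; _∈_; _⊆_; _≐_; _∩_; _∖_; ∅; Satisfiable)

private
  variable
    a p : Level
    A : Set a

Finite : {A : Set a} → Pred A p → Set _
Finite S = ∃ λ xs → S ≐ (_∈ˡ xs)

AtLeast : {A : Set a} → ℕ → Pred A p → Set _
AtLeast {A = A} k S = ∃ λ (f : Fin k ↣ A) → ∀ i → Injection.to f i ∈ S

Word : Set
Word = List ℕ

infix 4 _≼_

_≼_ : Word → Word → Set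
_≼_ = Prefix _≡_

record IsTree (T : Pred Word 0ℓ) : Set where
  field
    root   : Word
    root∈  : root ∈ T
    rooted : ∀ {τ} → τ ∈ T → root ≼ τ
    closed : ∀ {τ τ′} → root ++ τ ∈ T → τ′ ≼ τ → root ++ τ′ ∈ T

-- Atomic propositions are the elements of Fin n.

record KripkeTree (n : ℕ) : Set₁ where
  field
    nodes  : Pred Word 0ℓ
    isTree : IsTree nodes

  open IsTree isTree public

  -- The membership proof is irrelevant, so two nodes are equal as soon as
  -- the underlying words are, and predicates on Node are subsets of the tree.
  Node : Set
  Node = [ τ ∈ Word ∣ τ ∈ nodes ]

  rootNode : Node
  rootNode = root , [ root∈ ]

  post : Node → Pred Node 0ℓ
  post w v = ∃ λ k → value v ≡ value w ∷ʳ k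

  field
    nonBlocking : ∀ w → Satisfiable (post w)
    Lab         : Node → Subset n

FinitelyBranching : ∀ {n} → KripkeTree n → Set
FinitelyBranching 𝓣 = ∀ w → Finite (post w)
  where open KripkeTree 𝓣

record FiniteSubtree (T : Pred Word 0ℓ) : Set₁ where
  field
    carrier  : Pred Word 0ℓ
    subset   : carrier ⊆ T
    isTree   : IsTree carrier
    isFinite : Finite carrier

-- WMTL n i j: formulas over Fin n with i free first-order and j free
-- second-order variables, as de Bruijn indices.
data WMTL (n : ℕ) : (i j : ℕ) → Set where
  P    : ∀ {i j} → Fin n → Fin i → WMTL n i j
  _≤′_ : ∀ {i j} → Fin i → Fin i → WMTL n i j
  _∈′_ : ∀ {i j} → Fin i → Fin j → WMTL n i j
  ¬′_  : ∀ {i j} → WMTL n i j → WMTL n i j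
  _∧′_ : ∀ {i j} → WMTL n i j → WMTL n i j → WMTL n i j
  ∃′_  : ∀ {i j} → WMTL n (suc i) j → WMTL n i j
  ∃ᵗ_  : ∀ {i j} → WMTL n i (suc j) → WMTL n i j

WMTLSentence : ℕ → Set
WMTLSentence n = WMTL n 0 0

module _ {n : ℕ} (𝓣 : KripkeTree n) where
  open KripkeTree 𝓣

  Sat : ∀ {i j} → WMTL n i j →
        Vector Node i → Vector (FiniteSubtree nodes) j → Set₁
  Sat (P a x)  ρ σ = Lift _ (a ∈ˢ Lab (ρ x))
  Sat (x ≤′ y) ρ σ = Lift _ (value (ρ x) ≼ value (ρ y))
  Sat (x ∈′ X) ρ σ = Lift _ (value (ρ x) ∈ FiniteSubtree.carrier (σ X))
  Sat (¬′ φ)   ρ σ = ¬ Sat φ ρ σ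
  Sat (φ ∧′ ψ) ρ σ = Sat φ ρ σ × Sat ψ ρ σ
  Sat (∃′ φ)   ρ σ = ∃ λ x → Sat φ (x ▹ ρ) σ
  Sat (∃ᵗ φ)   ρ σ = ∃ λ X → Sat φ ρ (X ▹ σ)

  infix 4 _⊨ʷ_

  _⊨ʷ_ : WMTLSentence n → Set₁
  _⊨ʷ_ φ = Sat φ ⟨⟩ ⟨⟩

Var : Set
Var = ℕ

data Op : Set where
  μ ν : Op

dual : Op → Op
dual μ = ν
dual ν = μ

_·_ : Sign → Op → Op
+ · η = η
- · η = dual η

-- Base n s Z O and Fix n Z O are the formulas φ_{Z,O} and ϑ_{Z,O}, the finite
-- sets Z and O being given by lists.  The sign s is the parity of the number
-- of negations between the innermost enclosing ϑ_{∅,∅} and the base formula;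
-- variables are admitted only at sign +.  An embedded ϑ_{∅,∅} is closed, so
-- the count restarts there.
mutual
  data Base (n : ℕ) : Sign → (Z O : List Var) → Set where
    bot   : ∀ {s Z O} → Base n s Z O
    top   : ∀ {s Z O} → Base n s Z O
    atom  : ∀ {s Z O} → Fin n → Base n s Z O
    neg   : ∀ {s Z O} → Base n (opposite s) Z O → Base n s Z O
    _and_ : ∀ {s Z O} → Base n s Z O → Base n s Z O → Base n s Z O
    _or_  : ∀ {s Z O} → Base n s Z O → Base n s Z O → Base n s Z O
    ◇≥    : ∀ {s Z O} → ℕ → Base n s O [] → Base n s Z O
    □<    : ∀ {s Z O} → ℕ → Base n s O [] → Base n s Z O
    var   : ∀ {Z O} (X : Var) → X ∈ˡ Z → Base n + Z O
    emb   : ∀ {s Z O} → Fix n [] [] → Base n s Z O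

  data Fix (n : ℕ) : (Z O : List Var) → Set where
    fix  : ∀ {Z O} → Op → (X : Var) → Fix n (X ∷ Z) (X ∷ O) → Fix n Z O
    base : ∀ {Z O} → Base n + Z O → Fix n Z O

OSGMCSentence : ℕ → Set
OSGMCSentence n = Fix n [] []

-- Positive normal form.  The sign d says whether the enclosing block of
-- fixpoint operators is being dualised; a variable bound by a dualised block
-- stands for the complement of its former value, so it is left unchanged.
-- A base formula of sign s is negated when d * s is -.
mutual
  pnfᵇ : ∀ {n s Z O} → Sign → Base n s Z O → Base n + Z O
  pnfᵇ {s = s} d bot with d * s
  ... | + = bot
  ... | - = top
  pnfᵇ {s = s} d top with d * s
  ... | + = top
  ... | - = bot
  pnfᵇ {s = s} d (atom a) with d * s
  ... | + = atom a
  ... | - = neg (atom a)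
  pnfᵇ d (neg φ) = pnfᵇ d φ
  pnfᵇ {s = s} d (φ and ψ) with d * s
  ... | + = pnfᵇ d φ and pnfᵇ d ψ
  ... | - = pnfᵇ d φ or pnfᵇ d ψ
  pnfᵇ {s = s} d (φ or ψ) with d * s
  ... | + = pnfᵇ d φ or pnfᵇ d ψ
  ... | - = pnfᵇ d φ and pnfᵇ d ψ
  pnfᵇ {s = s} d (◇≥ k φ) with d * s
  ... | + = ◇≥ k (pnfᵇ d φ)
  ... | - = □< k (pnfᵇ d φ)
  pnfᵇ {s = s} d (□< k φ) with d * s
  ... | + = □< k (pnfᵇ d φ)
  ... | - = ◇≥ k (pnfᵇ d φ)
  pnfᵇ d (var X X∈Z) = var X X∈Z
  pnfᵇ {s = s} d (emb ϑ) = emb (pnfᶠ (d * s) ϑ)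

  pnfᶠ : ∀ {n Z O} → Sign → Fix n Z O → Fix n Z O
  pnfᶠ d (fix η X ϑ) = fix (d · η) X (pnfᶠ d ϑ)
  pnfᶠ d (base φ)    = base (pnfᵇ d φ)

data Formula (n : ℕ) : Set where
  ⌊_⌋ᵇ : ∀ {s Z O} → Base n s Z O → Formula n
  ⌊_⌋ᶠ : ∀ {Z O} → Fix n Z O → Formula n

infix 4 _◂_ _⊴_ _⊴[_]_

data _◂_ {n : ℕ} : Formula n → Formula n → Set where
  neg  : ∀ {s Z O} {φ : Base n (opposite s) Z O} →
         ⌊ φ ⌋ᵇ ◂ ⌊ neg {s = s} φ ⌋ᵇ
  andˡ : ∀ {s Z O} {φ ψ : Base n s Z O} → ⌊ φ ⌋ᵇ ◂ ⌊ φ and ψ ⌋ᵇ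
  andʳ : ∀ {s Z O} {φ ψ : Base n s Z O} → ⌊ ψ ⌋ᵇ ◂ ⌊ φ and ψ ⌋ᵇ
  orˡ  : ∀ {s Z O} {φ ψ : Base n s Z O} → ⌊ φ ⌋ᵇ ◂ ⌊ φ or ψ ⌋ᵇ
  orʳ  : ∀ {s Z O} {φ ψ : Base n s Z O} → ⌊ ψ ⌋ᵇ ◂ ⌊ φ or ψ ⌋ᵇ
  ◇≥   : ∀ {s Z O k} {φ : Base n s O []} → ⌊ φ ⌋ᵇ ◂ ⌊ ◇≥ {Z = Z} k φ ⌋ᵇ
  □<   : ∀ {s Z O k} {φ : Base n s O []} → ⌊ φ ⌋ᵇ ◂ ⌊ □< {Z = Z} k φ ⌋ᵇ
  emb  : ∀ {s Z O} {ϑ : Fix n [] []} → ⌊ ϑ ⌋ᶠ ◂ ⌊ emb {s = s} {Z} {O} ϑ ⌋ᵇ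
  fix  : ∀ {Z O η X} {ϑ : Fix n (X ∷ Z) (X ∷ O)} → ⌊ ϑ ⌋ᶠ ◂ ⌊ fix η X ϑ ⌋ᶠ
  base : ∀ {Z O} {φ : Base n + Z O} → ⌊ φ ⌋ᵇ ◂ ⌊ base φ ⌋ᶠ

data Binds {n : ℕ} (X : Var) : Formula n → Set where
  fix : ∀ {Z O η} {ϑ : Fix n (X ∷ Z) (X ∷ O)} → Binds X ⌊ fix η X ϑ ⌋ᶠ

_⊴_ : ∀ {n} → Formula n → Formula n → Set
_⊴_ = Star _◂_

-- ψ ⊴[ X ] φ: ψ occurs in φ outside the scope of every binder of X in φ, so
-- that X free in ψ and X free in φ denote the same variable.
_⊴[_]_ : ∀ {n} → Formula n → Var → Formula n → Set
ψ ⊴[ X ] φ = Star (λ ψ′ φ′ → ψ′ ◂ φ′ × ¬ Binds X φ′) ψ φ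

FreeIn : ∀ {n} → Var → Formula n → Set
FreeIn {n} X φ =
  ∃ λ Z → ∃ λ O → ∃ λ (X∈Z : X ∈ˡ Z) → ⌊ var {n} {Z} {O} X X∈Z ⌋ᵇ ⊴[ X ] φ

AlternationFree : ∀ {n} → OSGMCSentence n → Set
AlternationFree {n} ϑ =
  ∀ {Z O Z′ O′ η X Y} {α : Fix n (X ∷ Z) (X ∷ O)} {β : Fix n (Y ∷ Z′) (Y ∷ O′)} →
  ⌊ fix η X α ⌋ᶠ ⊴ ⌊ pnfᶠ + ϑ ⌋ᶠ →
  ⌊ fix (dual η) Y β ⌋ᶠ ⊴[ X ] ⌊ α ⌋ᶠ →
  ¬ FreeIn X ⌊ fix (dual η) Y β ⌋ᶠ

module _ {n : ℕ} (𝓣 : KripkeTree n) where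
  open KripkeTree 𝓣

  Assignment : Set₁
  Assignment = Var → Pred Node 0ℓ

  _[_↦_] : Assignment → Var → Pred Node 0ℓ → Assignment
  (χ [ X ↦ W ]) Y with Y ≟ X
  ... | yes _ = W
  ... | no  _ = χ Y

  -- The fixpoint clauses quantify over all subsets W, which puts denotations
  -- one universe above the values of assignments.
  mutual
    ⟦_⟧ᵇ : ∀ {s Z O} → Base n s Z O → Assignment → Pred Node (lsuc 0ℓ)
    ⟦ bot ⟧ᵇ     χ w = ⊥
    ⟦ top ⟧ᵇ     χ w = ⊤
    ⟦ atom a ⟧ᵇ  χ w = Lift _ (a ∈ˢ Lab w)
    ⟦ neg φ ⟧ᵇ   χ w = ¬ (w ∈ ⟦ φ ⟧ᵇ χ)
    ⟦ φ and ψ ⟧ᵇ χ w = w ∈ ⟦ φ ⟧ᵇ χ × w ∈ ⟦ ψ ⟧ᵇ χ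
    ⟦ φ or ψ ⟧ᵇ  χ w = w ∈ ⟦ φ ⟧ᵇ χ ⊎ w ∈ ⟦ ψ ⟧ᵇ χ
    ⟦ ◇≥ k φ ⟧ᵇ  χ w = AtLeast k (post w ∩ ⟦ φ ⟧ᵇ χ)
    ⟦ □< k φ ⟧ᵇ  χ w = ¬ AtLeast k (post w ∖ ⟦ φ ⟧ᵇ χ)
    ⟦ var X _ ⟧ᵇ χ w = Lift _ (w ∈ χ X)
    ⟦ emb ϑ ⟧ᵇ   χ w = w ∈ ⟦ ϑ ⟧ᶠ χ

    ⟦_⟧ᶠ : ∀ {Z O} → Fix n Z O → Assignment → Pred Node (lsuc 0ℓ)
    ⟦ fix μ X ϑ ⟧ᶠ χ w =
      ∀ (W : Pred Node 0ℓ) → ⟦ ϑ ⟧ᶠ (χ [ X ↦ W ]) ⊆ W → w ∈ W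
    ⟦ fix ν X ϑ ⟧ᶠ χ w =
      ∃ λ (W : Pred Node 0ℓ) → W ⊆ ⟦ ϑ ⟧ᶠ (χ [ X ↦ W ]) × w ∈ W
    ⟦ base φ ⟧ᶠ    χ w = w ∈ ⟦ φ ⟧ᵇ χ

  infix 4 _⊨ᵍ_

  -- A sentence is closed, so the choice of assignment is immaterial.
  _⊨ᵍ_ : OSGMCSentence n → Set₁
  _⊨ᵍ_ ϑ = rootNode ∈ ⟦ ϑ ⟧ᶠ (λ _ → ∅)

{-# OPTIONS --safe #-}

-- A one-step formula at a node constrains its variables only at the node and
-- at its children.  By alternation-freeness all effective operators of a
-- block η₁X₁.…ηₘXₘ.φ are of one kind, so the block denotes a single least or
-- greatest fixpoint; by complementation let it be the least fixpoint of F.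
-- Over finitely-branching trees, w belongs to it iff there is a finite subtree
-- Y with root w such that every subtree X ⊆ Y containing w has a node in
-- F (Y ∖ X).  If w is outside a prefixed point W, the component of w in Y ∖ W
-- is an X without such a node; conversely the w having such a Y form a
-- prefixed point, as the trees Y of the children can be glued below w.
module Submission where

open import Defs
open import Axiom.ExcludedMiddle using (ExcludedMiddle)
open import Data.Empty using (⊥; ⊥-elim; ⊥-elim-irr)
open import Data.Fin.Base using (Fin; zero; suc)
open import Data.Fin.Properties using (0≢1+n; suc-injective)
open import Data.Irrelevant using ([_])
open import Data.List.Base using (List; []; _∷_; _++_; _∷ʳ_; filter; concatMap)
open import Data.List.Membership.Propositional using (find; lose) renaming (_∈_ to _∈ˡ_)
open import Data.List.Membership.Propositional.Properties
  using (∈-filter⁺; ∈-filter⁻; ∈-++⁺ˡ; ∈-++⁺ʳ; ∈-++⁻;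
         ∈-concatMap⁺; ∈-concatMap⁻)
open import Data.List.Properties using (++-assoc; ++-identityʳ)
open import Data.List.Relation.Binary.Pointwise using (≡⇒Pointwise-≡; Pointwise-≡⇒≡)
open import Data.List.Relation.Binary.Prefix.Heterogeneous using ([]; _∷_)
import Data.List.Relation.Binary.Prefix.Heterogeneous.Properties as Prefix
open import Data.List.Relation.Unary.Any using (here; there)
open import Data.Nat.Base using (ℕ; zero; suc)
open import Data.Nat.Properties using (_≟_)
open import Data.Product.Base using (∃; _×_; _,_; proj₁; proj₂)
open import Data.Product.Function.NonDependent.Propositional using (_×-⇔_)
open import Data.Refinement.Base using (value; _,_)
open import Data.Sign.Base using (Sign; +; -; opposite; _*_)
open import Data.Sum.Base using (_⊎_; inj₁; inj₂; map)
open import Data.Unit.Base using (⊤; tt)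
open import Data.Vec.Functional using (Vector) renaming (_∷_ to _▹_)
open import Function.Base using (id; _∘_; case_of_)
open import Function.Bundles using (_⇔_; mk⇔; mk↣; Equivalence; Injection)
open import Function.Construct.Composition using (_⇔-∘_)
open import Function.Construct.Identity using (⇔-id)
open import Function.Construct.Symmetry using (⇔-sym)
open import Function.Related.TypeIsomorphisms using (¬-cong-⇔)
open import Level using (0ℓ; Lift; lift; lower) renaming (suc to lsuc)
open import Relation.Binary.Construct.Closure.ReflexiveTransitive using (ε; _◅_; _◅◅_)
open import Relation.Binary.PropositionalEquality using (_≡_; refl; sym; trans; cong; subst)
open import Relation.Nullary using (¬_; Dec; yes; no)
open import Relation.Nullary.Decidable using (True; toWitness; fromWitness; decidable-stable; map′)
open import Relation.Unary using (Pred; _∈_; _⊆_; _∪_; _∩_; _∖_; ∁; ∅)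

private
  variable
    n : ℕ
    s : Sign
    Z O : List Var
    X Y : Var
    η η′ : Op

-- Alternation-freeness of a block

pnf : Sign → Formula n → Formula n
pnf d ⌊ φ ⌋ᵇ = ⌊ pnfᵇ d φ ⌋ᵇ
pnf d ⌊ ϑ ⌋ᶠ = ⌊ pnfᶠ d ϑ ⌋ᶠ

-- Normal forms erase `neg`, so ψ and `neg` ψ may have the same image. The sign changes only at
-- `emb`, where the parity counted so far is absorbed into it because counting restarts.
pnf-◂ : {ψ φ : Formula n} → ψ ◂ φ → ∀ d →
        ∃ λ d′ → pnf d′ ψ ≡ pnf d φ ⊎ pnf d′ ψ ◂ pnf d φ
pnf-◂ neg d = d , inj₁ refl
pnf-◂ (andˡ {s}) d with d * s
... | + = d , inj₂ andˡ
... | - = d , inj₂ orˡ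
pnf-◂ (andʳ {s}) d with d * s
... | + = d , inj₂ andʳ
... | - = d , inj₂ orʳ
pnf-◂ (orˡ {s}) d with d * s
... | + = d , inj₂ orˡ
... | - = d , inj₂ andˡ
pnf-◂ (orʳ {s}) d with d * s
... | + = d , inj₂ orʳ
... | - = d , inj₂ andʳ
pnf-◂ (◇≥ {s}) d with d * s
... | + = d , inj₂ ◇≥
... | - = d , inj₂ □<
pnf-◂ (□< {s}) d with d * s
... | + = d , inj₂ □<
... | - = d , inj₂ ◇≥
pnf-◂ (emb {s}) d = d * s , inj₂ emb
pnf-◂ fix d = d , inj₂ fix
pnf-◂ base d = d , inj₂ base

Binds-pnf⁻ : ∀ d (φ : Formula n) → Binds X (pnf d φ) → Binds X φ
Binds-pnf⁻ d ⌊ fix η X ϑ ⌋ᶠ fix = fix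

FreeIn-◂ : {ψ φ : Formula n} → ψ ◂ φ → ¬ Binds X φ → FreeIn X ψ → FreeIn X φ
FreeIn-◂ ψ◂φ unbound (_ , _ , X∈Z , path) = _ , _ , X∈Z , path ◅◅ (ψ◂φ , unbound) ◅ ε

-- Normal forms keep variables and the names at binders, so the path from the occurrence is
-- transported upwards step by step, for all signs at once since `emb` changes the sign.
FreeIn-pnf⁺ : {φ : Formula n} → FreeIn X φ → ∀ d → FreeIn X (pnf d φ)
FreeIn-pnf⁺ {n} {X} (_ , _ , X∈Z , path) = go path (λ d → _ , _ , X∈Z , ε)
  where
  go : {ψ φ : Formula n} → ψ ⊴[ X ] φ →
       (∀ d → FreeIn X (pnf d ψ)) → ∀ d → FreeIn X (pnf d φ)
  go ε free = free
  go (_◅_ {j = φ} (ψ◂φ , unbound) path) free = go path λ d → step d (pnf-◂ ψ◂φ d)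
    where
    step : ∀ d → (∃ λ d′ → pnf d′ _ ≡ pnf d φ ⊎ pnf d′ _ ◂ pnf d φ) → FreeIn X (pnf d φ)
    step d (d′ , inj₁ eq)  = subst (FreeIn X) eq (free d′)
    step d (d′ , inj₂ ψ◂φ) = FreeIn-◂ ψ◂φ (unbound ∘ Binds-pnf⁻ d φ) (free d′)

-- The step at the binder is the last one of the path and is peeled off from the far end; it exists
-- because the path starts at a variable.
FreeIn-fix⁻ : {ϑ : Fix n (X ∷ Z) (X ∷ O)} → FreeIn Y ⌊ fix η X ϑ ⌋ᶠ →
              FreeIn Y ⌊ ϑ ⌋ᶠ × ¬ Binds Y ⌊ fix η X ϑ ⌋ᶠ
FreeIn-fix⁻ {n = n} {Y = Y} (_ , _ , Y∈Z , path) with unsnoc path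
  where
  unsnoc : ∀ {X Z O η} {ϑ : Fix n (X ∷ Z) (X ∷ O)} {ψ} → ψ ⊴[ Y ] ⌊ fix η X ϑ ⌋ᶠ →
           ψ ≡ ⌊ fix η X ϑ ⌋ᶠ ⊎ (ψ ⊴[ Y ] ⌊ ϑ ⌋ᶠ × ¬ Binds Y ⌊ fix η X ϑ ⌋ᶠ)
  unsnoc ε = inj₁ refl
  unsnoc (step ◅ path) with unsnoc path
  ... | inj₂ (path , unbound) = inj₂ (step ◅ path , unbound)
  unsnoc ((fix , unbound) ◅ path) | inj₁ refl = inj₂ (ε , unbound)
... | inj₂ (path , unbound) = (_ , _ , Y∈Z , path) , unbound

unbound : {ϑ : Fix n (X ∷ Z) (X ∷ O)} → ¬ Y ≡ X → ¬ Binds Y ⌊ fix η X ϑ ⌋ᶠ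
unbound Y≢X fix = Y≢X refl

≢⇒∈-tail : ¬ Y ≡ X → Y ∈ˡ (X ∷ Z) → Y ∈ˡ Z
≢⇒∈-tail Y≢X (here Y≡X)  = ⊥-elim (Y≢X Y≡X)
≢⇒∈-tail Y≢X (there Y∈Z) = Y∈Z

NoAlternation : Formula n → Set
NoAlternation {n} φ =
  ∀ {Z O Z′ O′ η X Y} {α : Fix n (X ∷ Z) (X ∷ O)} {β : Fix n (Y ∷ Z′) (Y ∷ O′)} →
  ⌊ fix η X α ⌋ᶠ ⊴ φ → ⌊ fix (dual η) Y β ⌋ᶠ ⊴[ X ] ⌊ α ⌋ᶠ →
  ¬ FreeIn X ⌊ fix (dual η) Y β ⌋ᶠ

NoAlternation-◂ : {ψ φ : Formula n} → ψ ◂ φ → NoAlternation φ → NoAlternation ψ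
NoAlternation-◂ ψ◂φ na path = na (path ◅◅ ψ◂φ ◅ ε)

-- The invariant of the recursion over formulas: the sign depends on the embeddings crossed so far,
-- hence the existential.
NoAlternationPnf : Formula n → Set
NoAlternationPnf φ = ∃ λ d → NoAlternation (pnf d φ)

NoAlternationPnf-◂ : {ψ φ : Formula n} → ψ ◂ φ → NoAlternationPnf φ → NoAlternationPnf ψ
NoAlternationPnf-◂ ψ◂φ (d , na) with pnf-◂ ψ◂φ d
... | d′ , inj₁ eq  = d′ , subst NoAlternation (sym eq) na
... | d′ , inj₂ ψ◂φ = d′ , NoAlternation-◂ ψ◂φ na

lastOp : Op → Fix n Z O → Op
lastOp η (fix η′ X ϑ) = lastOp η′ ϑ
lastOp η (base φ)     = η

-- Alternation-freeness still admits operators of a kind other than the innermost one, provided that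
-- their variable does not occur in their scope.
Uniform : Op → Fix n Z O → Set
Uniform η (fix η′ X ϑ) = (η′ ≡ η ⊎ ¬ FreeIn X ⌊ ϑ ⌋ᶠ) × Uniform η ϑ
Uniform η (base φ)     = ⊤

FreeInBinder : Op → Var → Formula n → Set
FreeInBinder {n} η X φ =
  ∃ λ Z → ∃ λ O → ∃ λ Y → ∃ λ (β : Fix n (Y ∷ Z) (Y ∷ O)) →
  ⌊ fix η Y β ⌋ᶠ ⊴[ X ] φ × FreeIn X ⌊ fix η Y β ⌋ᶠ

≡⊎dual : ∀ η η′ → η ≡ η′ ⊎ η′ ≡ dual η
≡⊎dual μ μ = inj₁ refl
≡⊎dual μ ν = inj₂ refl
≡⊎dual ν μ = inj₂ refl
≡⊎dual ν ν = inj₁ refl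

-- A variable free in the body of a block is free already in the innermost
-- binder, so it cannot belong to an operator dual to the innermost one.
uniform : ∀ η X (ϑ : Fix n (X ∷ Z) (X ∷ O)) → NoAlternation ⌊ fix η X ϑ ⌋ᶠ →
          Uniform (lastOp η ϑ) (fix η X ϑ) ×
          (∀ {Y} → FreeIn Y ⌊ fix η X ϑ ⌋ᶠ → FreeInBinder (lastOp η ϑ) Y ⌊ fix η X ϑ ⌋ᶠ)
uniform η X (base φ) na =
  (inj₁ refl , tt) , λ free → _ , _ , _ , _ , ε , free
uniform η X (fix η′ X′ ϑ) na with uniform η′ X′ ϑ (NoAlternation-◂ fix na)
... | uni , innermost = (first (≡⊎dual η (lastOp η′ ϑ)) , uni) , innermost′
  where
  first : η ≡ lastOp η′ ϑ ⊎ lastOp η′ ϑ ≡ dual η →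
          η ≡ lastOp η′ ϑ ⊎ ¬ FreeIn X ⌊ fix η′ X′ ϑ ⌋ᶠ
  first (inj₁ eq) = inj₁ eq
  first (inj₂ eq) = inj₂ λ free →
    let _ , _ , _ , _ , path , free′ = subst (λ η → FreeInBinder η X _) eq (innermost free)
    in na ε path free′
  innermost′ : ∀ {Y} → FreeIn Y ⌊ fix η X (fix η′ X′ ϑ) ⌋ᶠ →
               FreeInBinder (lastOp η′ ϑ) Y ⌊ fix η X (fix η′ X′ ϑ) ⌋ᶠ
  innermost′ free =
    let free′ , unbound = FreeIn-fix⁻ free
        _ , _ , _ , _ , path , free″ = innermost free′
    in _ , _ , _ , _ , path ◅◅ (fix , unbound) ◅ ε , free″

·-involutive : ∀ d η → d · (d · η) ≡ η
·-involutive + η = refl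
·-involutive - μ = refl
·-involutive - ν = refl

lastOp-pnf : ∀ d η (ϑ : Fix n Z O) → lastOp (d · η) (pnfᶠ d ϑ) ≡ d · lastOp η ϑ
lastOp-pnf d η (fix η′ X ϑ) = lastOp-pnf d η′ ϑ
lastOp-pnf d η (base φ)     = refl

Uniform-pnf⁻ : ∀ d (ϑ : Fix n Z O) → Uniform (d · η) (pnfᶠ d ϑ) → Uniform η ϑ
Uniform-pnf⁻ d (base φ) _ = tt
Uniform-pnf⁻ {η = η} d (fix η′ X ϑ) (inj₁ eq , uni) =
  inj₁ (trans (sym (·-involutive d η′)) (trans (cong (d ·_) eq) (·-involutive d η))) ,
  Uniform-pnf⁻ d ϑ uni
Uniform-pnf⁻ d (fix η′ X ϑ) (inj₂ notFree , uni) =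
  inj₂ (λ free → notFree (FreeIn-pnf⁺ free d)) , Uniform-pnf⁻ d ϑ uni

uniform-lastOp : (ϑ : Fix n Z O) → NoAlternationPnf ⌊ ϑ ⌋ᶠ → Uniform (lastOp μ ϑ) ϑ
uniform-lastOp (base φ) _ = tt
uniform-lastOp (fix η X ϑ) (d , na) =
  Uniform-pnf⁻ d (fix η X ϑ)
    (subst (λ η′ → Uniform η′ (pnfᶠ d (fix η X ϑ))) (lastOp-pnf d η ϑ)
      (proj₁ (uniform (d · η) X (pnfᶠ d ϑ) na)))

-- Prefixes

≼-refl : ∀ {a} → a ≼ a
≼-refl = Prefix.fromPointwise (≡⇒Pointwise-≡ refl)

≼-trans : ∀ {a b c} → a ≼ b → b ≼ c → a ≼ c
≼-trans = Prefix.trans trans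

≼-antisym : ∀ {a b} → a ≼ b → b ≼ a → a ≡ b
≼-antisym a≼b b≼a = Pointwise-≡⇒≡ (Prefix.antisym (λ eq _ → eq) a≼b b≼a)

a≼a++b : ∀ a {b} → a ≼ a ++ b
a≼a++b []      = []
a≼a++b (_ ∷ a) = refl ∷ a≼a++b a

≼⇒++ : ∀ {a b} → a ≼ b → ∃ λ c → b ≡ a ++ c
≼⇒++ []           = _ , refl
≼⇒++ (refl ∷ a≼b) with _ , refl ← ≼⇒++ a≼b = _ , refl

++-mono-≼ : ∀ a {b c} → b ≼ c → a ++ b ≼ a ++ c
++-mono-≼ []      b≼c = b≼c
++-mono-≼ (_ ∷ a) b≼c = refl ∷ ++-mono-≼ a b≼c

++-cancel-≼ : ∀ a {b c} → a ++ b ≼ a ++ c → b ≼ c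
++-cancel-≼ []      b≼c       = b≼c
++-cancel-≼ (_ ∷ a) (_ ∷ b≼c) = ++-cancel-≼ a b≼c

≼-total-below : ∀ {a b c} → a ≼ c → b ≼ c → a ≼ b ⊎ b ≼ a
≼-total-below []           _            = inj₁ []
≼-total-below (_ ∷ _)      []           = inj₂ []
≼-total-below (refl ∷ a≼c) (refl ∷ b≼c) with ≼-total-below a≼c b≼c
... | inj₁ a≼b = inj₁ (refl ∷ a≼b)
... | inj₂ b≼a = inj₂ (refl ∷ b≼a)

≼-between-∷ʳ : ∀ a {b k} → a ≼ b → b ≼ a ∷ʳ k → b ≡ a ⊎ b ≡ a ∷ʳ k
≼-between-∷ʳ []      _            []           = inj₁ refl
≼-between-∷ʳ []      _            (refl ∷ [])  = inj₂ refl
≼-between-∷ʳ (_ ∷ a) (refl ∷ a≼b) (_ ∷ b≼ak) with ≼-between-∷ʳ a a≼b b≼ak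
... | inj₁ refl = inj₁ refl
... | inj₂ refl = inj₂ refl

∷ʳ-⋠ : ∀ a {k} → ¬ (a ∷ʳ k ≼ a)
∷ʳ-⋠ (_ ∷ a) (_ ∷ ak≼a) = ∷ʳ-⋠ a ak≼a

module _ {C : Pred Word 0ℓ} where

  -- The root is a prefix of a, hence of b and c; once it is split off, `closed` compares the
  -- remaining words.
  convex : IsTree C → ∀ {a b c} → a ∈ C → c ∈ C → a ≼ b → b ≼ c → b ∈ C
  convex tree a∈C c∈C a≼b b≼c
    with _ , refl ← ≼⇒++ (≼-trans (IsTree.rooted tree a∈C) a≼b)
       | _ , refl ← ≼⇒++ (IsTree.rooted tree c∈C)
    = IsTree.closed tree c∈C (++-cancel-≼ (IsTree.root tree) b≼c)

  convex⇒isTree : ∀ r → r ∈ C → (∀ {a} → a ∈ C → r ≼ a) →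
                  (∀ {a b} → b ∈ C → r ≼ a → a ≼ b → a ∈ C) → IsTree C
  convex⇒isTree r r∈C rooted down = record
    { root   = r
    ; root∈  = r∈C
    ; rooted = rooted
    ; closed = λ b∈C a≼b → down b∈C (a≼a++b r) (++-mono-≼ r a≼b)
    }

-- Fixpoints of set operators

module _ {A : Set} where

  -- As in the semantics, candidate sets W live one universe below the values of F, so a fixpoint is
  -- not itself a candidate until it is resized.
  Fixpoint : Op → (Pred A 0ℓ → Pred A (lsuc 0ℓ)) → Pred A (lsuc 0ℓ)
  Fixpoint μ F w = ∀ (W : Pred A 0ℓ) → F W ⊆ W → w ∈ W
  Fixpoint ν F w = ∃ λ (W : Pred A 0ℓ) → W ⊆ F W × w ∈ W

  Fixpoint-mono : ∀ η {F G : Pred A 0ℓ → Pred A (lsuc 0ℓ)} →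
                  (∀ W → F W ⊆ G W) → Fixpoint η F ⊆ Fixpoint η G
  Fixpoint-mono μ F⊆G w∈μF W GW⊆W          = w∈μF W (GW⊆W ∘ F⊆G W)
  Fixpoint-mono ν F⊆G (W , W⊆FW , w∈W) = W , F⊆G W ∘ W⊆FW , w∈W

  Fixpoint-cong : ∀ η {F G : Pred A 0ℓ → Pred A (lsuc 0ℓ)} {w} →
                  (∀ W {v} → v ∈ F W ⇔ v ∈ G W) → w ∈ Fixpoint η F ⇔ w ∈ Fixpoint η G
  Fixpoint-cong η F⇔G = mk⇔
    (Fixpoint-mono η λ W → Equivalence.to (F⇔G W))
    (Fixpoint-mono η λ W → Equivalence.from (F⇔G W))

-- The translation

infix  25 ∀′_ ∀ᵗ_
infixr 15 _⇒′_

_⇒′_ : ∀ {i j} → WMTL n i j → WMTL n i j → WMTL n i j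
φ ⇒′ ψ = ¬′ (φ ∧′ (¬′ ψ))

∀′_ : ∀ {i j} → WMTL n (suc i) j → WMTL n i j
∀′ φ = ¬′ (∃′ (¬′ φ))

∀ᵗ_ : ∀ {i j} → WMTL n i (suc j) → WMTL n i j
∀ᵗ φ = ¬′ (∃ᵗ (¬′ φ))

_≐′_ : ∀ {i j} → Fin i → Fin i → WMTL n i j
x ≐′ y = (x ≤′ y) ∧′ (y ≤′ x)

-- WMTL has only the descendant order, of which this is the covering relation.
child : ∀ {i j} → Fin i → Fin i → WMTL n i j
child x y = ((x ≤′ y) ∧′ (¬′ (y ≤′ x))) ∧′
  (¬′ (∃′ (((suc x ≤′ zero) ∧′ (zero ≤′ suc y)) ∧′
           ((¬′ (zero ≤′ suc x)) ∧′ (¬′ (suc y ≤′ zero))))))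

isRoot : ∀ {i j} → Fin i → WMTL n i j
isRoot x = ∀′ (suc x ≤′ zero)

-- Given in every first-order context, such a formula can be placed under further first-order
-- quantifiers without weakening syntax.
Unary : ℕ → ℕ → Set
Unary n j = ∀ i → Fin i → WMTL n i j

-- A unary formula together with its weakenings by first-order variables.
Open : ℕ → ℕ → ℕ → Set
Open n i j = ∀ {i′} → (Fin i → Fin i′) → Fin i′ → WMTL n i′ j

-- Each quantifier picks one witness, and r is strengthened to exclude it from later choices. At
-- `zero`, x ≤ x stands for truth.
count : ∀ {i j} → ℕ → Fin i → Open n i j → WMTL n i j
count zero    x r = x ≤′ x
count (suc k) x r =
  ∃′ (r suc zero ∧′ count k zero (λ f y → r (f ∘ suc) y ∧′ (¬′ (y ≐′ f zero))))

-- Inside `body`, the set variable `suc zero` is the certificate Y and `zero` its subtree X.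
certified : ∀ {j} → Unary n (suc (suc j)) → Unary n j
certified body i x = ∃ᵗ
  (((x ∈′ zero) ∧′ (∀′ ((zero ∈′ zero) ⇒′ (suc x ≤′ zero)))) ∧′
   (∀ᵗ (((x ∈′ zero) ∧′ (∀′ ((zero ∈′ zero) ⇒′ (zero ∈′ suc zero)))) ⇒′
        (∃′ ((zero ∈′ zero) ∧′ body (suc i) zero)))))

difference : ∀ {j} → Unary n (suc (suc j))
difference i x = (x ∈′ suc zero) ∧′ (¬′ (x ∈′ zero))

not : ∀ {j} → Unary n j → Unary n j
not u i x = ¬′ u i x

-- The case `ν` rests on νF = ∁ μ(W ↦ ∁ F (∁ W)).
block : Op → (∀ {j} → Unary n j → Unary n j) → ∀ {j} → Unary n j
block μ body = certified (body difference)
block ν body = not (certified (not (body (not difference))))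

mutual
  -- One formula u interprets every variable in scope, because all variables of a block share one
  -- value once it is merged into a single fixpoint.
  trᵇ : ∀ {j} → Base n s Z O → Unary n j → Unary n j
  trᵇ bot       u i x = ¬′ (x ≤′ x)
  trᵇ top       u i x = x ≤′ x
  trᵇ (atom a)  u i x = P a x
  trᵇ (neg φ)   u i x = ¬′ trᵇ φ u i x
  trᵇ (φ and ψ) u i x = trᵇ φ u i x ∧′ trᵇ ψ u i x
  trᵇ (φ or ψ)  u i x = (¬′ trᵇ φ u i x) ⇒′ trᵇ ψ u i x
  trᵇ (◇≥ k φ)  u i x = count k x λ f y → child (f x) y ∧′ trᵇ φ u _ y
  trᵇ (□< k φ)  u i x = ¬′ count k x λ f y → child (f x) y ∧′ (¬′ trᵇ φ u _ y)
  trᵇ (var X _) u i x = u i x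
  trᵇ (emb ϑ)   u i x = trᶠ ϑ i x

  trBody : ∀ {j} → Fix n Z O → Unary n j → Unary n j
  trBody (fix η X ϑ) u = trBody ϑ u
  trBody (base φ)    u = trᵇ φ u

  trᶠ : ∀ {j} → Fix n [] [] → Unary n j
  -- The default `μ` concerns blocks without fixpoint operators: they denote a constant, which is
  -- its own least fixpoint.
  trᶠ ϑ = block (lastOp μ ϑ) (trBody ϑ)

sentence : Fix n [] [] → WMTLSentence n
sentence ϑ = ∃′ (isRoot zero ∧′ trᶠ ϑ _ zero)

-- The value at `zero` is split off and injectivity becomes distinctness from it, as in the
-- recursion of `count`.
AtLeast-suc : ∀ {A : Set} {k} {R : Pred A (lsuc 0ℓ)} →
  AtLeast (suc k) R ⇔ (∃ λ v → v ∈ R × AtLeast k (λ u → u ∈ R × ¬ u ≡ v))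
AtLeast-suc {A} {k} {R} = mk⇔ to from
  where
  to : AtLeast (suc k) R → ∃ λ v → v ∈ R × AtLeast k (λ u → u ∈ R × ¬ u ≡ v)
  to (f , f∈) = Injection.to f zero , f∈ zero ,
    mk↣ {to = Injection.to f ∘ suc} (λ eq → suc-injective (Injection.injective f eq)) ,
    λ i → f∈ (suc i) , λ eq → 0≢1+n (sym (Injection.injective f eq))
  from : (∃ λ v → v ∈ R × AtLeast k (λ u → u ∈ R × ¬ u ≡ v)) → AtLeast (suc k) R
  from (v , v∈ , f , f∈) = mk↣ {to = g} injective , g∈
    where
    g : Fin (suc k) → A
    g zero    = v
    g (suc i) = Injection.to f i
    g∈ : ∀ i → g i ∈ R
    g∈ zero    = v∈
    g∈ (suc i) = proj₁ (f∈ i)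
    injective : ∀ {i j} → g i ≡ g j → i ≡ j
    injective {zero}  {zero}  _  = refl
    injective {zero}  {suc j} eq = ⊥-elim (proj₂ (f∈ j) (sym eq))
    injective {suc i} {zero}  eq = ⊥-elim (proj₂ (f∈ i) eq)
    injective {suc i} {suc j} eq = cong suc (Injection.injective f eq)

∃-cong : ∀ {a b c} {A : Set a} {B : A → Set b} {C : A → Set c} →
         (∀ x → B x ⇔ C x) → ∃ B ⇔ ∃ C
∃-cong B⇔C = mk⇔
  (λ (x , b) → x , Equivalence.to (B⇔C x) b)
  (λ (x , c) → x , Equivalence.from (B⇔C x) c)

-- Classical logic, finiteness and fixpoint laws

module Classical (em : ExcludedMiddle (lsuc 0ℓ)) where

  em₀ : ExcludedMiddle 0ℓ
  em₀ = map′ lower lift em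

  stable : {A : Set₁} → ¬ ¬ A → A
  stable = decidable-stable em

  ¬×¬⇔→ : {A B : Set₁} → (¬ (A × ¬ B)) ⇔ (A → B)
  ¬×¬⇔→ = mk⇔
    (λ ¬a×¬b a → stable λ ¬b → ¬a×¬b (a , ¬b))
    (λ a→b (a , ¬b) → ¬b (a→b a))

  ¬∃¬⇔∀ : ∀ {a} {A : Set a} {B : A → Set₁} → (¬ ∃ λ x → ¬ B x) ⇔ (∀ x → B x)
  ¬∃¬⇔∀ = mk⇔
    (λ ∄¬b x → stable λ ¬b → ∄¬b (x , ¬b))
    (λ ∀b (x , ¬b) → ¬b (∀b x))

  ⌞⌟⁺ : {A : Set₁} → A → True (em {A})
  ⌞⌟⁺ = fromWitness

  ⌞⌟⁻ : {A : Set₁} → True (em {A}) → A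
  ⌞⌟⁻ = toWitness

  unirrelevant : {A : Set} → .A → A
  unirrelevant {A} a with em₀ {A}
  ... | yes a′ = a′
  ... | no ¬a  = ⊥-elim-irr (¬a a)

  Finite-⊆ : {A : Set} {S T : Pred A 0ℓ} → S ⊆ T → Finite T → Finite S
  Finite-⊆ {S = S} S⊆T (xs , T⊆xs , xs⊆T) =
    filter S? xs ,
    (λ x∈S → ∈-filter⁺ S? (T⊆xs (S⊆T x∈S)) x∈S) ,
    λ x∈ → proj₂ (∈-filter⁻ S? {xs = xs} x∈)
    where
    S? : ∀ x → Dec (x ∈ S)
    S? x = em₀

  module _ {A : Set} where

    -- Resizing: `True` of a decision lives in the lowest universe whatever is decided, so a
    -- fixpoint can serve as a candidate set.
    ⌞_⌟ : Pred A (lsuc 0ℓ) → Pred A 0ℓ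
    ⌞ S ⌟ w = True (em {S w})

    Fixpoint-const : ∀ η {F : Pred A 0ℓ → Pred A (lsuc 0ℓ)} →
                     (∀ U V → F U ⊆ F V) → ∀ {w} → Fixpoint η F w ⇔ F ∅ w
    Fixpoint-const μ {F} const = mk⇔
      (λ w∈μF → ⌞⌟⁻ (w∈μF ⌞ F ∅ ⌟ (λ {_} v∈F → ⌞⌟⁺ (const _ ∅ v∈F))))
      (λ w∈F W FW⊆W → FW⊆W (const ∅ W w∈F))
    Fixpoint-const ν {F} const = mk⇔
      (λ (W , W⊆FW , w∈W) → const W ∅ (W⊆FW w∈W))
      (λ w∈F → ⌞ F ∅ ⌟ , (λ {_} v∈ → const ∅ _ (⌞⌟⁻ v∈)) , ⌞⌟⁺ w∈F)

    Fixpoint-diagonal : ∀ η {H : Pred A 0ℓ → Pred A 0ℓ → Pred A (lsuc 0ℓ)} →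
      (∀ {U U′ V V′} → U ⊆ U′ → V ⊆ V′ → H U V ⊆ H U′ V′) →
      ∀ {w} → Fixpoint η (λ U → Fixpoint η (H U)) w ⇔ Fixpoint η (λ U → H U U) w
    Fixpoint-diagonal μ {H} mono {w} = mk⇔ to from
      where
      to : Fixpoint μ (λ U → Fixpoint μ (H U)) w → Fixpoint μ (λ U → H U U) w
      to w∈μμH W HWW⊆W = w∈μμH W λ v∈μHW → v∈μHW W HWW⊆W
      from : Fixpoint μ (λ U → H U U) w → Fixpoint μ (λ U → Fixpoint μ (H U)) w
      -- Test with W = μ(H U): W ⊆ U since U is prefixed, and W ⊆ V for every V prefixed under H U,
      -- so H W W ⊆ H U V ⊆ V.
      from w∈μH U μHU⊆U = μHU⊆U (⌞⌟⁻ (w∈μH ⌞ Fixpoint μ (H U) ⌟ λ v∈H → ⌞⌟⁺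
        λ V HUV⊆V → HUV⊆V (mono (λ u∈ → μHU⊆U (⌞⌟⁻ u∈)) (λ u∈ → ⌞⌟⁻ u∈ V HUV⊆V) v∈H)))
    Fixpoint-diagonal ν {H} mono {w} = mk⇔ to from
      where
      to : Fixpoint ν (λ U → Fixpoint ν (H U)) w → Fixpoint ν (λ U → H U U) w
      -- W = ν(H U) contains U, and each v in W lies in some V ⊆ H U V with V ⊆ W, hence in H W W.
      to (U , U⊆νHU , w∈U) = ⌞ Fixpoint ν (H U) ⌟ , postfixed , ⌞⌟⁺ (U⊆νHU w∈U)
        where
        postfixed : ⌞ Fixpoint ν (H U) ⌟ ⊆ H ⌞ Fixpoint ν (H U) ⌟ ⌞ Fixpoint ν (H U) ⌟
        postfixed v∈ with V , V⊆HUV , v∈V ← ⌞⌟⁻ v∈ =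
          mono (λ u∈U → ⌞⌟⁺ (U⊆νHU u∈U)) (λ u∈V → ⌞⌟⁺ (V , V⊆HUV , u∈V)) (V⊆HUV v∈V)
      from : Fixpoint ν (λ U → H U U) w → Fixpoint ν (λ U → Fixpoint ν (H U)) w
      from (W , W⊆HWW , w∈W) = W , (λ v∈W → W , W⊆HWW , v∈W) , w∈W

    -- Complementation exchanges postfixed points of F with prefixed points of its dual;
    -- monotonicity absorbs the double complement.
    Fixpoint-ν⇔¬μ : ∀ {F : Pred A 0ℓ → Pred A (lsuc 0ℓ)} →
      (∀ {U V} → U ⊆ V → F U ⊆ F V) →
      ∀ {w} → Fixpoint ν F w ⇔ (¬ Fixpoint μ (λ W → ∁ (F (∁ W))) w)
    Fixpoint-ν⇔¬μ {F} mono {w} = mk⇔ to from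
      where
      to : Fixpoint ν F w → ¬ Fixpoint μ (λ W → ∁ (F (∁ W))) w
      to (W , W⊆FW , w∈W) w∈μ =
        w∈μ (∁ W) (λ v∉F v∈W → v∉F (mono (λ u∈W u∉W → u∉W u∈W) (W⊆FW v∈W))) w∈W
      from : ¬ Fixpoint μ (λ W → ∁ (F (∁ W))) w → Fixpoint ν F w
      from w∉μ = stable λ w∉ν → w∉μ λ W ∁F∁W⊆W → decidable-stable em₀ λ w∉W →
        w∉ν (∁ W , (λ v∉W → stable λ v∉F → v∉W (∁F∁W⊆W v∉F)) , w∉W)

  Finite-∪ : {A : Set} {S T : Pred A 0ℓ} → Finite S → Finite T → Finite (S ∪ T)
  Finite-∪ (xs , S⊆xs , xs⊆S) (ys , T⊆ys , ys⊆T) =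
    xs ++ ys ,
    (λ { (inj₁ x∈S) → ∈-++⁺ˡ (S⊆xs x∈S) ; (inj₂ x∈T) → ∈-++⁺ʳ xs (T⊆ys x∈T) }) ,
    λ x∈ → map xs⊆S ys⊆T (∈-++⁻ xs x∈)

  Finite-⋃ : {I A : Set} {S : Pred I 0ℓ} {T : I → Pred A 0ℓ} →
             Finite S → (∀ i → Finite (T i)) → Finite (λ a → ∃ λ i → i ∈ S × a ∈ T i)
  Finite-⋃ (is , S⊆is , is⊆S) finite =
    concatMap (proj₁ ∘ finite) is ,
    (λ (i , i∈S , a∈T) →
       ∈-concatMap⁺ (proj₁ ∘ finite) (lose (S⊆is i∈S) (proj₁ (proj₂ (finite i)) a∈T))) ,
    λ a∈ → let i , i∈is , a∈xs = find (∈-concatMap⁻ (proj₁ ∘ finite) {xs = is} a∈)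
           in i , is⊆S i∈is , proj₂ (proj₂ (finite i)) a∈xs

  -- Certificates for least fixpoints on finitely-branching trees

  module OnTree {n} (𝓣 : KripkeTree n) (finitelyBranching : FinitelyBranching 𝓣) where
    open KripkeTree 𝓣 using (nodes; Node; rootNode; post; Lab)
    open FiniteSubtree

    value-injective : {v w : Node} → value v ≡ value w → v ≡ w
    value-injective refl = refl

    value∈nodes : (w : Node) → value w ∈ nodes
    value∈nodes (_ , [ w∈ ]) = unirrelevant w∈

    -- This is all that certificates use of the one-step syntax.
    LocallyMonotone : (Pred Node 0ℓ → Pred Node (lsuc 0ℓ)) → Set₁
    LocallyMonotone F = ∀ {U V w} → (w ∈ U → w ∈ V) →
      (∀ {v} → post w v → v ∈ U → v ∈ V) → w ∈ F U → w ∈ F V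

    _∖ᵗ_ : FiniteSubtree nodes → FiniteSubtree nodes → Pred Node 0ℓ
    (Y ∖ᵗ X) v = value v ∈ carrier Y × ¬ value v ∈ carrier X

    RootedAt : Node → FiniteSubtree nodes → Set
    RootedAt w Y = value w ∈ carrier Y × (∀ (v : Node) → value v ∈ carrier Y → value w ≼ value v)

    -- No connected part X of Y around w is left wholly unjustified: the rest of Y already forces F
    -- at some node of X.
    Certificate : (Pred Node 0ℓ → Pred Node (lsuc 0ℓ)) → Node → FiniteSubtree nodes → Set₁
    Certificate F w Y = ∀ (X : FiniteSubtree nodes) → value w ∈ carrier X →
      (∀ (v : Node) → value v ∈ carrier X → value v ∈ carrier Y) →
      ∃ λ v → value v ∈ carrier X × v ∈ F (Y ∖ᵗ X)

    Certified : (Pred Node 0ℓ → Pred Node (lsuc 0ℓ)) → Pred Node (lsuc 0ℓ)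
    Certified F w = ∃ λ Y → RootedAt w Y × Certificate F w Y

    module _ {F : Pred Node 0ℓ → Pred Node (lsuc 0ℓ)} (local : LocallyMonotone F) where

      -- If w lies outside a prefixed point W, the certificate is refuted by
      -- the component of w in Y ∖ W: a child of this component that is in Y
      -- but not in the component belongs to W.
      certified⇒μ : Certified F ⊆ Fixpoint μ F
      certified⇒μ {w} (Y , (w∈Y , _) , cert) W FW⊆W = decidable-stable em₀ refute
        where
        C : Pred Word 0ℓ
        C a = a ∈ carrier Y × value w ≼ a ×
              (∀ (u : Node) → value w ≼ value u → value u ≼ a → ¬ u ∈ W)

        module _ (w∉W : ¬ w ∈ W) where

          w∈C : C (value w)
          w∈C = w∈Y , ≼-refl , λ u w≼u u≼w u∈W →
            w∉W (subst W (value-injective (≼-antisym u≼w w≼u)) u∈W)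

          component : FiniteSubtree nodes
          component = record
            { carrier  = C
            ; subset   = subset Y ∘ proj₁
            ; isTree   = convex⇒isTree (value w) w∈C (proj₁ ∘ proj₂)
                λ (b∈Y , _ , avoid) w≼a a≼b →
                  convex (isTree Y) w∈Y b∈Y w≼a a≼b , w≼a ,
                  λ u w≼u u≼a → avoid u w≼u (≼-trans u≼a a≼b)
            ; isFinite = Finite-⊆ proj₁ (isFinite Y)
            }

          refute : ⊥
          refute with cert component w∈C (λ _ → proj₁)
          -- v is outside Y ∖ C, and its children in Y ∖ C lie in W. By locality v is in F W ⊆ W,
          -- which `avoid` excludes.
          ... | v , (v∈Y , w≼v , avoid) , v∈F = avoid v w≼v ≼-refl
            (FW⊆W (local (λ (_ , v∉C) → ⊥-elim (v∉C (v∈Y , w≼v , avoid))) below v∈F))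
            where
            below : ∀ {u} → post v u → u ∈ (Y ∖ᵗ component) → u ∈ W
            -- Were u outside W, it would join the component: a node between w and u is a prefix of
            -- v or u itself.
            below {u} (k , refl) (u∈Y , u∉C) = decidable-stable em₀ λ u∉W →
              u∉C (u∈Y , ≼-trans w≼v (a≼a++b (value v)) , avoid′ u∉W)
              where
              avoid′ : ¬ u ∈ W → ∀ u′ → value w ≼ value u′ → value u′ ≼ value u → ¬ u′ ∈ W
              avoid′ u∉W u′ w≼u′ u′≼u u′∈W
                with ≼-total-below u′≼u (a≼a++b (value v))
              ... | inj₁ u′≼v = avoid u′ w≼u′ u′≼v u′∈W
              ... | inj₂ v≼u′ with ≼-between-∷ʳ (value v) v≼u′ u′≼u
              ...   | inj₁ u′≡v = avoid u′ w≼u′ (subst (_≼ value v) (sym u′≡v) ≼-refl) u′∈W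
              ...   | inj₂ u′≡u = u∉W (subst W (value-injective u′≡u) u′∈W)

      μ⇒certified : Fixpoint μ F ⊆ Certified F
      μ⇒certified w∈μF = ⌞⌟⁻ (w∈μF S (λ {w} → prefixed {w}))
        where
        S : Pred Node 0ℓ
        S = ⌞ Certified F ⌟

        -- The tree of a chosen certificate of z, if any. The decision is an argument so that
        -- properties can be proved by cases on it; gluing passes `em`.
        part : (z : Node) → Dec (Certified F z) → Pred Word 0ℓ
        part z (yes (Y , _)) = carrier Y
        part z (no _)        = ∅

        part-finite : ∀ z d → Finite (part z d)
        part-finite z (yes (Y , _)) = isFinite Y
        part-finite z (no _)        = [] , (λ ()) , λ ()

        part-convex : ∀ z d {a b} → part z d b → value z ≼ a → a ≼ b → part z d a
        part-convex z (yes (Y , (z∈Y , _) , _)) b∈Y = convex (isTree Y) z∈Y b∈Y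

        part-rooted : ∀ z d {a} → part z d a → value z ≼ a
        part-rooted z (yes (Y , (_ , rooted) , _)) a∈Y = rooted (_ , [ subset Y a∈Y ]) a∈Y

        part-certificate : ∀ z d → Certified F z → ∃ λ Y →
          RootedAt z Y × Certificate F z Y × carrier Y ⊆ part z d
        part-certificate z (yes (Y , rooted , cert)) _ = Y , rooted , cert , id
        part-certificate z (no ¬certified) certified   = ⊥-elim (¬certified certified)

        part-subset : ∀ z d {a} → part z d a → a ∈ nodes
        part-subset z (yes (Y , _)) = subset Y

        -- The goal being stable, w may be assumed uncertified; the comparison of S with
        -- `glued ∖ᵗ X` is then vacuous at w itself.
        module _ (w : Node) (w∈FS : w ∈ F S) (w∉S : ¬ w ∈ S) where

          C : Pred Word 0ℓ
          C a = a ≡ value w ⊎ ∃ λ z → post w z × part z em a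

          C-rooted : ∀ {a} → C a → value w ≼ a
          C-rooted (inj₁ refl) = ≼-refl
          C-rooted (inj₂ (z , (k , refl) , a∈)) =
            ≼-trans (a≼a++b (value w)) (part-rooted z em a∈)

          C-down : ∀ {a b} → C b → value w ≼ a → a ≼ b → C a
          C-down (inj₁ refl) w≼a a≼w = inj₁ (≼-antisym a≼w w≼a)
          C-down (inj₂ (z , (k , refl) , b∈)) w≼a a≼b
            with ≼-total-below (part-rooted z em b∈) a≼b
          ... | inj₁ z≼a = inj₂ (z , (k , refl) , part-convex z em b∈ z≼a a≼b)
          ... | inj₂ a≼z with ≼-between-∷ʳ (value w) w≼a a≼z
          ...   | inj₁ a≡w  = inj₁ a≡w
          ...   | inj₂ refl = inj₂ (z , (k , refl) , part-convex z em b∈ ≼-refl a≼b)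

          glued : FiniteSubtree nodes
          glued = record
            { carrier  = C
            ; subset   = λ { (inj₁ refl) → value∈nodes w
                           ; (inj₂ (z , _ , a∈)) → part-subset z em a∈ }
            ; isTree   = convex⇒isTree (value w) (inj₁ refl) C-rooted C-down
            -- Finite branching enters here: finitely many children contribute a finite tree each.
            ; isFinite = Finite-∪
                (value w ∷ [] , (λ { refl → here refl }) , λ { (here refl) → refl })
                (Finite-⋃ (finitelyBranching w) (λ z → part-finite z em))
            }

          -- If X contains no certified child of w, then w is the witness, as all certified children
          -- lie in `glued ∖ᵗ X`. Otherwise the certificate Y of a certified child in X is applied
          -- to X ∩ Y.
          certificate : Certificate F w glued
          certificate X w∈X X⊆ with em {∃ λ z → post w z × value z ∈ carrier X × Certified F z}
          ... | no none = w , w∈X , local {S} {glued ∖ᵗ X} (⊥-elim ∘ w∉S) (λ {z} → outside {z}) w∈FS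
            where
            outside : ∀ {z} → post w z → z ∈ S → z ∈ (glued ∖ᵗ X)
            outside {z} w→z z∈S =
              let _ , (z∈Y , _) , _ , Y⊆part = part-certificate z em (⌞⌟⁻ z∈S)
              in inj₂ (z , w→z , Y⊆part z∈Y) , λ z∈X → none (z , w→z , z∈X , ⌞⌟⁻ z∈S)
          ... | yes (z , w→z , z∈X , certified)
            with Y , (z∈Y , rooted) , cert , Y⊆part ← part-certificate z em certified =
            -- Y ∖ (X ∩ Y) is contained in `glued ∖ᵗ X`, so a witness against X ∩ Y is one against
            -- X.
            let v , (v∈X , v∈Y) , v∈F = cert below (z∈X , z∈Y) (λ _ → proj₂)
            in v , v∈X , local {Y ∖ᵗ below} {glued ∖ᵗ X} (enlarge v) (λ {u} _ → enlarge u) v∈F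
            where
            below : FiniteSubtree nodes
            below = record
              { carrier  = carrier X ∩ carrier Y
              ; subset   = subset X ∘ proj₁
              ; isTree   = convex⇒isTree (value z) (z∈X , z∈Y)
                  (λ (_ , a∈Y) → rooted (_ , [ subset Y a∈Y ]) a∈Y)
                  λ (b∈X , b∈Y) z≼a a≼b →
                    convex (isTree X) z∈X b∈X z≼a a≼b , convex (isTree Y) z∈Y b∈Y z≼a a≼b
              ; isFinite = Finite-⊆ proj₁ (isFinite X)
              }

            enlarge : ∀ u → u ∈ (Y ∖ᵗ below) → u ∈ (glued ∖ᵗ X)
            enlarge u (u∈Y , u∉below) =
              inj₂ (z , w→z , Y⊆part u∈Y) , λ u∈X → u∉below (u∈X , u∈Y)

        prefixed : F S ⊆ S
        prefixed {w} w∈FS = decidable-stable em₀ λ w∉S → w∉S (⌞⌟⁺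
          (glued w w∈FS w∉S , (inj₁ refl , λ v → C-rooted w w∈FS w∉S) , certificate w w∈FS w∉S))

    -- Locality and monotonicity of one-step formulas

    -- Implication directed by the parity of negations, so that one induction covers both
    -- polarities.
    Le : Sign → Set₁ → Set₁ → Set₁
    Le + A B = A → B
    Le - A B = B → A

    Le-both : ∀ s {A B} → (A → B) → (B → A) → Le s A B
    Le-both + f g = f
    Le-both - f g = g

    Le-¬ : ∀ s {A B} → Le (opposite s) A B → Le s (¬ A) (¬ B)
    Le-¬ + f ¬a b = ¬a (f b)
    Le-¬ - f ¬b a = ¬b (f a)

    Le-× : ∀ s {A B C D} → Le s A B → Le s C D → Le s (A × C) (B × D)
    Le-× + f g (a , c) = f a , g c
    Le-× - f g (b , d) = f b , g d

    Le-⊎ : ∀ s {A B C D} → Le s A B → Le s C D → Le s (A ⊎ C) (B ⊎ D)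
    Le-⊎ + = map
    Le-⊎ - = map

    Le-◇ : ∀ s k {w P Q} → (∀ v → post w v → Le s (v ∈ P) (v ∈ Q)) →
           Le s (AtLeast k (post w ∩ P)) (AtLeast k (post w ∩ Q))
    Le-◇ + k P≤Q (f , f∈) =
      f , λ i → proj₁ (f∈ i) , P≤Q (Injection.to f i) (proj₁ (f∈ i)) (proj₂ (f∈ i))
    Le-◇ - k P≤Q (f , f∈) =
      f , λ i → proj₁ (f∈ i) , P≤Q (Injection.to f i) (proj₁ (f∈ i)) (proj₂ (f∈ i))

    Le-□ : ∀ s k {w P Q} → (∀ v → post w v → Le s (v ∈ P) (v ∈ Q)) →
           Le s (¬ AtLeast k (post w ∖ P)) (¬ AtLeast k (post w ∖ Q))
    Le-□ + k P≤Q ¬P (f , f∈) =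
      ¬P (f , λ i → proj₁ (f∈ i) , proj₂ (f∈ i) ∘ P≤Q (Injection.to f i) (proj₁ (f∈ i)))
    Le-□ - k P≤Q ¬Q (f , f∈) =
      ¬Q (f , λ i → proj₁ (f∈ i) , proj₂ (f∈ i) ∘ P≤Q (Injection.to f i) (proj₁ (f∈ i)))

    _⟨_↦_⟩ : Assignment 𝓣 → Var → Pred Node 0ℓ → Assignment 𝓣
    χ ⟨ X ↦ W ⟩ = _[_↦_] 𝓣 χ X W

    ↦-mono : ∀ χ χ′ X Y {V V′ w} → (w ∈ V → w ∈ V′) → (¬ Y ≡ X → w ∈ χ Y → w ∈ χ′ Y) →
             w ∈ (χ ⟨ X ↦ V ⟩) Y → w ∈ (χ′ ⟨ X ↦ V′ ⟩) Y
    ↦-mono χ χ′ X Y V≤V′ χ≤χ′ with Y ≟ X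
    ... | yes _  = V≤V′
    ... | no Y≢X = χ≤χ′ Y≢X

    fix-Fixpoint : ∀ {Z O} η X (ϑ : Fix n (X ∷ Z) (X ∷ O)) χ {w} →
      w ∈ ⟦_⟧ᶠ 𝓣 (fix η X ϑ) χ ⇔ w ∈ Fixpoint η (λ W → ⟦_⟧ᶠ 𝓣 ϑ (χ ⟨ X ↦ W ⟩))
    fix-Fixpoint μ X ϑ χ = ⇔-id _
    fix-Fixpoint ν X ϑ χ = ⇔-id _

    -- Variables in Z can be evaluated at w and those in O at its children, so χ and χ′ need
    -- comparing only there.
    LocallyBelow : Formula n → (Z O : List Var) → Assignment 𝓣 → Assignment 𝓣 → Node → Set
    LocallyBelow φ Z O χ χ′ w = ∀ {Y} → FreeIn Y φ →
      (Y ∈ˡ Z → w ∈ χ Y → w ∈ χ′ Y) ×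
      (Y ∈ˡ O → ∀ {v} → post w v → v ∈ χ Y → v ∈ χ′ Y)

    ◂-below : ∀ {ψ φ Z O χ χ′ w} → ψ ◂ φ → (∀ {X} → ¬ Binds X φ) →
              LocallyBelow φ Z O χ χ′ w → LocallyBelow ψ Z O χ χ′ w
    ◂-below ψ◂φ unbound below free = below (FreeIn-◂ ψ◂φ unbound free)

    -- Beneath a modality O takes the place of Z and nothing replaces O, so no variable is evaluated
    -- at a grandchild of w.
    modal-below : ∀ {ψ φ Z O χ χ′ w} → ψ ◂ φ → (∀ {X} → ¬ Binds X φ) →
                  LocallyBelow φ Z O χ χ′ w → ∀ {v} → post w v → LocallyBelow ψ O [] χ χ′ v
    modal-below ψ◂φ unbound below {v} w→v free =
      (λ Y∈O → proj₂ (below (FreeIn-◂ ψ◂φ unbound free)) Y∈O {v} w→v) , λ ()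

    mutual
      localᵇ : ∀ {s Z O χ χ′ w} (φ : Base n s Z O) → LocallyBelow ⌊ φ ⌋ᵇ Z O χ χ′ w →
               Le s (w ∈ ⟦_⟧ᵇ 𝓣 φ χ) (w ∈ ⟦_⟧ᵇ 𝓣 φ χ′)
      localᵇ {s} bot       below = Le-both s id id
      localᵇ {s} top       below = Le-both s id id
      localᵇ {s} (atom a)  below = Le-both s id id
      localᵇ {s} (neg φ)   below = Le-¬ s (localᵇ φ (◂-below neg (λ ()) below))
      localᵇ {s} (φ and ψ) below =
        Le-× s (localᵇ φ (◂-below andˡ (λ ()) below)) (localᵇ ψ (◂-below andʳ (λ ()) below))
      localᵇ {s} (φ or ψ)  below =
        Le-⊎ s (localᵇ φ (◂-below orˡ (λ ()) below)) (localᵇ ψ (◂-below orʳ (λ ()) below))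
      localᵇ {s} {χ = χ} {χ′} {w} (◇≥ k φ) below =
        Le-◇ s k {w} λ v w→v → localᵇ {χ = χ} {χ′} {v} φ (modal-below ◇≥ (λ ()) below {v} w→v)
      localᵇ {s} {χ = χ} {χ′} {w} (□< k φ) below =
        Le-□ s k {w} λ v w→v → localᵇ {χ = χ} {χ′} {v} φ (modal-below □< (λ ()) below {v} w→v)
      localᵇ (var X X∈Z)   below (lift w∈) = lift (proj₁ (below (_ , _ , X∈Z , ε)) X∈Z w∈)
      -- An embedded sentence has no variables in scope, so monotonicity applies to arbitrary
      -- assignments in both directions.
      localᵇ {s} {χ = χ} {χ′} (emb ϑ) below =
        Le-both s (monoᶠ ϑ (closed χ χ′)) (monoᶠ ϑ (closed χ′ χ))
        where
        closed : ∀ (χ χ′ : Assignment 𝓣) {Y} → FreeIn Y ⌊ ϑ ⌋ᶠ → Y ∈ˡ [] ⊎ Y ∈ˡ [] → χ Y ⊆ χ′ Y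
        closed _ _ _ (inj₁ ())
        closed _ _ _ (inj₂ ())

      monoᶠ : ∀ {Z O χ χ′} (ϑ : Fix n Z O) →
              (∀ {Y} → FreeIn Y ⌊ ϑ ⌋ᶠ → Y ∈ˡ Z ⊎ Y ∈ˡ O → χ Y ⊆ χ′ Y) →
              ⟦_⟧ᶠ 𝓣 ϑ χ ⊆ ⟦_⟧ᶠ 𝓣 ϑ χ′
      monoᶠ {χ = χ} {χ′} (fix η X ϑ) below w∈ =
        Equivalence.from (fix-Fixpoint η X ϑ χ′)
          (Fixpoint-mono η (λ W → monoᶠ ϑ (below′ W)) (Equivalence.to (fix-Fixpoint η X ϑ χ) w∈))
        where
        below′ : ∀ W {Y} → FreeIn Y ⌊ ϑ ⌋ᶠ → Y ∈ˡ (X ∷ _) ⊎ Y ∈ˡ (X ∷ _) →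
                 (χ ⟨ X ↦ W ⟩) Y ⊆ (χ′ ⟨ X ↦ W ⟩) Y
        below′ W {Y} free Y∈ = ↦-mono χ χ′ X Y {W} id λ Y≢X →
          below (FreeIn-◂ fix (unbound Y≢X) free) (map (≢⇒∈-tail Y≢X) (≢⇒∈-tail Y≢X) Y∈)
      monoᶠ (base φ) below = localᵇ φ λ free →
        (λ Y∈Z → below (FreeIn-◂ base (λ ()) free) (inj₁ Y∈Z)) ,
        λ Y∈O _ → below (FreeIn-◂ base (λ ()) free) (inj₂ Y∈O)

    -- One value V for all variables of the block: the diagonal that remains when its operators are
    -- merged.
    blockOperator : ∀ {Z O} → Fix n Z O → Assignment 𝓣 → Pred Node 0ℓ → Pred Node (lsuc 0ℓ)
    blockOperator (fix η X ϑ) χ V = blockOperator ϑ (χ ⟨ X ↦ V ⟩) V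
    blockOperator (base φ)    χ V = ⟦_⟧ᵇ 𝓣 φ χ

    blockOperator-local : ∀ {Z O χ χ′ V V′ w} (ϑ : Fix n Z O) →
      LocallyBelow ⌊ ϑ ⌋ᶠ Z O χ χ′ w →
      (w ∈ V → w ∈ V′) → (∀ {v} → post w v → v ∈ V → v ∈ V′) →
      w ∈ blockOperator ϑ χ V → w ∈ blockOperator ϑ χ′ V′
    blockOperator-local {χ = χ} {χ′} {V} {V′} (fix η X ϑ) below here≤ below≤ =
      blockOperator-local ϑ
        (λ {Y} free →
          (λ Y∈ → ↦-mono χ χ′ X Y {V} {V′} here≤ λ Y≢X →
            proj₁ (below (FreeIn-◂ fix (unbound Y≢X) free)) (≢⇒∈-tail Y≢X Y∈)) ,
          λ Y∈ w→v → ↦-mono χ χ′ X Y {V} {V′} (below≤ w→v) λ Y≢X →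
            proj₂ (below (FreeIn-◂ fix (unbound Y≢X) free)) (≢⇒∈-tail Y≢X Y∈) w→v)
        here≤ below≤
    blockOperator-local (base φ) below _ _ = localᵇ φ (◂-below base (λ ()) below)

    blockOperator-mono : ∀ {Z O χ χ′ V V′} (ϑ : Fix n Z O) →
      (∀ {Y} → FreeIn Y ⌊ ϑ ⌋ᶠ → χ Y ⊆ χ′ Y) → V ⊆ V′ →
      blockOperator ϑ χ V ⊆ blockOperator ϑ χ′ V′
    blockOperator-mono ϑ χ⊆χ′ V⊆V′ =
      blockOperator-local ϑ (λ free → (λ _ → χ⊆χ′ free) , λ _ _ → χ⊆χ′ free) V⊆V′ (λ _ → V⊆V′)

    -- Operators of the same kind as the innermost one are merged by the
    -- diagonal law; the others bind no occurrence and disappear.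
    block-Fixpoint : ∀ {Z O η w} (ϑ : Fix n Z O) χ → Uniform η ϑ →
      w ∈ ⟦_⟧ᶠ 𝓣 ϑ χ ⇔ w ∈ Fixpoint η (blockOperator ϑ χ)
    block-Fixpoint {η = η} (base φ) χ _ = ⇔-sym (Fixpoint-const η (λ _ _ → id))
    block-Fixpoint {η = η} (fix η′ X ϑ) χ (same⊎free , uni) =
      merge same⊎free ⇔-∘
      (Fixpoint-cong η′ (λ W → block-Fixpoint ϑ (χ ⟨ X ↦ W ⟩) uni) ⇔-∘ fix-Fixpoint η′ X ϑ χ)
      where
      merge : ∀ {w} → η′ ≡ η ⊎ ¬ FreeIn X ⌊ ϑ ⌋ᶠ →
        w ∈ Fixpoint η′ (λ W → Fixpoint η (blockOperator ϑ (χ ⟨ X ↦ W ⟩))) ⇔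
        w ∈ Fixpoint η (λ W → blockOperator ϑ (χ ⟨ X ↦ W ⟩) W)
      merge (inj₁ refl) = Fixpoint-diagonal η λ {U} {U′} U⊆U′ V⊆V′ →
        blockOperator-mono ϑ (λ {Y} _ → ↦-mono χ χ X Y {U} {U′} U⊆U′ (λ _ → id)) V⊆V′
      merge (inj₂ notFree) =
        Fixpoint-cong η (λ W → mk⇔ (irrelevant ∅ W) (irrelevant W ∅)) ⇔-∘
        Fixpoint-const η′ (λ U V → Fixpoint-mono η λ W → irrelevant U V)
        where
        irrelevant : ∀ U V {W} → blockOperator ϑ (χ ⟨ X ↦ U ⟩) W ⊆ blockOperator ϑ (χ ⟨ X ↦ V ⟩) W
        irrelevant U V = blockOperator-mono ϑ agree id
          where
          agree : ∀ {Y} → FreeIn Y ⌊ ϑ ⌋ᶠ → (χ ⟨ X ↦ U ⟩) Y ⊆ (χ ⟨ X ↦ V ⟩) Y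
          agree {Y} free with Y ≟ X
          ... | yes refl = ⊥-elim (notFree free)
          ... | no _     = id

    -- Correctness of the translation

    module _ {i j} {ρ : Vector Node i} {σ : Vector (FiniteSubtree nodes) j} where

      Sat-≐ : ∀ x y → Sat 𝓣 (x ≐′ y) ρ σ ⇔ ρ x ≡ ρ y
      Sat-≐ x y = mk⇔
        (λ (lift x≼y , lift y≼x) → value-injective (≼-antisym x≼y y≼x))
        (λ eq → lift (subst (λ v → value (ρ x) ≼ value v) eq ≼-refl) ,
                lift (subst (λ v → value v ≼ value (ρ x)) eq ≼-refl))

      Sat-child : ∀ x y → Sat 𝓣 (child x y) ρ σ ⇔ post (ρ x) (ρ y)
      Sat-child x y = mk⇔ to from
        where
        to : Sat 𝓣 (child x y) ρ σ → post (ρ x) (ρ y)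
        to ((lift x≼y , y⋠x) , none) with ≼⇒++ x≼y
        ... | []    , eq =
          ⊥-elim (y⋠x (lift (subst (_≼ value (ρ x)) (sym (trans eq (++-identityʳ _))) ≼-refl)))
        ... | k ∷ r , eq = k , ≼-antisym y≼xk xk≼y
          where
          xk≼y : value (ρ x) ∷ʳ k ≼ value (ρ y)
          xk≼y = subst (value (ρ x) ∷ʳ k ≼_) (trans (++-assoc (value (ρ x)) (k ∷ []) r) (sym eq))
                   (a≼a++b (value (ρ x) ∷ʳ k))
          -- If y were not a prefix of this child of x on the way to y, the child would lie strictly
          -- between them.
          z : Node
          z = value (ρ x) ∷ʳ k ,
              [ convex (KripkeTree.isTree 𝓣) (value∈nodes (ρ x)) (value∈nodes (ρ y))
                  (a≼a++b (value (ρ x))) xk≼y ]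
          y≼xk : value (ρ y) ≼ value (ρ x) ∷ʳ k
          y≼xk = decidable-stable em₀ λ y⋠xk → none (z , (lift (a≼a++b (value (ρ x))) , lift xk≼y) ,
            (λ (lift xk≼x) → ∷ʳ-⋠ (value (ρ x)) xk≼x) , λ (lift y≼xk) → y⋠xk y≼xk)
        from : post (ρ x) (ρ y) → Sat 𝓣 (child x y) ρ σ
        from (k , eq) =
          (lift (subst (value (ρ x) ≼_) (sym eq) (a≼a++b (value (ρ x)))) ,
           λ (lift y≼x) → ∷ʳ-⋠ (value (ρ x)) (subst (_≼ value (ρ x)) eq y≼x)) ,
          between
          where
          between : ¬ Sat 𝓣 (∃′ (((suc x ≤′ zero) ∧′ (zero ≤′ suc y)) ∧′
                             ((¬′ (zero ≤′ suc x)) ∧′ (¬′ (suc y ≤′ zero))))) ρ σ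
          between (z , (lift x≼z , lift z≼y) , z⋠x , y⋠z)
            with ≼-between-∷ʳ (value (ρ x)) x≼z (subst (value z ≼_) eq z≼y)
          ... | inj₁ z≡x = z⋠x (lift (subst (_≼ value (ρ x)) (sym z≡x) ≼-refl))
          ... | inj₂ z≡y = y⋠z (lift (subst (_≼ value z) (trans z≡y (sym eq)) ≼-refl))

    -- Every quantifier of `count` extends the environment, so r is assumed correct in all
    -- extensions ρ′ of ρ along f. In the recursive call R loses the node v just chosen.
    Sat-count : ∀ {i j} k (x : Fin i) (r : Open n i j) (R : Pred Node (lsuc 0ℓ)) {ρ σ} →
      (∀ {i′} (f : Fin i → Fin i′) y ρ′ → (∀ z → ρ′ (f z) ≡ ρ z) → Sat 𝓣 (r f y) ρ′ σ ⇔ ρ′ y ∈ R) →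
      Sat 𝓣 (count k x r) ρ σ ⇔ AtLeast k R
    Sat-count zero x r R r⇔R = mk⇔
      (λ _ → mk↣ {to = λ ()} (λ { {()} }) , λ ())
      (λ _ → lift ≼-refl)
    Sat-count (suc k) x r R {ρ} {σ} r⇔R = ⇔-sym AtLeast-suc ⇔-∘ ∃-cong λ v →
      r⇔R suc zero (v ▹ ρ) (λ _ → refl) ×-⇔
      Sat-count k zero _ (λ u → u ∈ R × ¬ u ≡ v) λ f y ρ′ ρ′∘f≗ →
        r⇔R (f ∘ suc) y ρ′ (λ z → ρ′∘f≗ (suc z)) ×-⇔
        ¬-cong-⇔ (subst (λ u → Sat 𝓣 (y ≐′ f zero) ρ′ σ ⇔ ρ′ y ≡ u) (ρ′∘f≗ zero)
                    (Sat-≐ {σ = σ} y (f zero)))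

    Defines : ∀ {j} → Unary n j → Vector (FiniteSubtree nodes) j → Pred Node (lsuc 0ℓ) → Set₁
    Defines u σ S = ∀ {i} (x : Fin i) (ρ : Vector Node i) → Sat 𝓣 (u i x) ρ σ ⇔ ρ x ∈ S

    Defines₀ : ∀ {j} → Unary n j → Vector (FiniteSubtree nodes) j → Pred Node 0ℓ → Set₁
    Defines₀ u σ S = Defines u σ (λ v → Lift (lsuc 0ℓ) (v ∈ S))

    certified-Defines : ∀ {j} (body : Unary n (suc (suc j))) σ F →
      (∀ Y X → Defines body (X ▹ (Y ▹ σ)) (F (Y ∖ᵗ X))) →
      Defines (certified body) σ (Certified F)
    certified-Defines body σ F body⇔F {i} x ρ = ∃-cong λ Y → rooted Y ×-⇔ certificate Y
      where
      rooted : ∀ Y → Sat 𝓣 ((x ∈′ zero) ∧′ (∀′ ((zero ∈′ zero) ⇒′ (suc x ≤′ zero)))) ρ (Y ▹ σ) ⇔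
                     RootedAt (ρ x) Y
      rooted Y = mk⇔
        (λ (lift x∈Y , above) → x∈Y , λ v v∈Y →
          lower (Equivalence.to ¬×¬⇔→ (Equivalence.to ¬∃¬⇔∀ above v) (lift v∈Y)))
        (λ (x∈Y , above) → lift x∈Y , Equivalence.from ¬∃¬⇔∀ λ v →
          Equivalence.from ¬×¬⇔→ λ (lift v∈Y) → lift (above v v∈Y))

      included : ∀ Y X → Sat 𝓣 (∀′ ((zero ∈′ zero) ⇒′ (zero ∈′ suc zero))) ρ (X ▹ (Y ▹ σ)) ⇔
                         (∀ v → value v ∈ carrier X → value v ∈ carrier Y)
      included Y X = mk⇔
        (λ X⊆Y v v∈X →
          lower (Equivalence.to ¬×¬⇔→ (Equivalence.to ¬∃¬⇔∀ X⊆Y v) (lift v∈X)))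
        (λ X⊆Y → Equivalence.from ¬∃¬⇔∀ λ v →
          Equivalence.from ¬×¬⇔→ λ (lift v∈X) → lift (X⊆Y v v∈X))

      witnessed : ∀ Y X → Sat 𝓣 (∃′ ((zero ∈′ zero) ∧′ body (suc i) zero)) ρ (X ▹ (Y ▹ σ)) ⇔
                          (∃ λ v → value v ∈ carrier X × v ∈ F (Y ∖ᵗ X))
      witnessed Y X = ∃-cong λ v → mk⇔ lower lift ×-⇔ body⇔F Y X zero (v ▹ ρ)

      certificate : ∀ Y → Sat 𝓣
        (∀ᵗ (((x ∈′ zero) ∧′ (∀′ ((zero ∈′ zero) ⇒′ (zero ∈′ suc zero)))) ⇒′
             (∃′ ((zero ∈′ zero) ∧′ body (suc i) zero)))) ρ (Y ▹ σ) ⇔ Certificate F (ρ x) Y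
      certificate Y = mk⇔
        (λ cert X x∈X X⊆Y → Equivalence.to (witnessed Y X)
          (Equivalence.to ¬×¬⇔→ (Equivalence.to ¬∃¬⇔∀ cert X)
            (lift x∈X , Equivalence.from (included Y X) X⊆Y)))
        (λ cert → Equivalence.from ¬∃¬⇔∀ λ X → Equivalence.from ¬×¬⇔→
          λ (lift x∈X , X⊆Y) → Equivalence.from (witnessed Y X)
            (cert X x∈X (Equivalence.to (included Y X) X⊆Y)))

    certified⇔μ : ∀ {F} → LocallyMonotone F → ∀ {w} → w ∈ Certified F ⇔ w ∈ Fixpoint μ F
    certified⇔μ local = mk⇔ (certified⇒μ local) (μ⇒certified local)

    difference-Defines : ∀ {j} {σ : Vector (FiniteSubtree nodes) j} Y X →
      Defines₀ difference (X ▹ (Y ▹ σ)) (Y ∖ᵗ X)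
    difference-Defines Y X x ρ = mk⇔
      (λ (lift ∈Y , ∉X) → lift (∈Y , λ ∈X → ∉X (lift ∈X)))
      (λ (lift (∈Y , ∉X)) → lift ∈Y , λ (lift ∈X) → ∉X ∈X)

    not-Defines₀ : ∀ {j} (u : Unary n j) σ S → Defines₀ u σ S → Defines₀ (not u) σ (∁ S)
    not-Defines₀ u σ S u⇔S x ρ = mk⇔
      (λ ¬u → lift λ x∈S → ¬u (Equivalence.from (u⇔S x ρ) (lift x∈S)))
      (λ (lift x∉S) su → x∉S (lower (Equivalence.to (u⇔S x ρ) su)))

    VariablesDefined : ∀ {j} → (Z O : List Var) → Unary n j → Vector (FiniteSubtree nodes) j →
                       Assignment 𝓣 → Set₁
    VariablesDefined Z O u σ χ = ∀ {Y} → Y ∈ˡ Z ⊎ Y ∈ˡ O → Defines₀ u σ (χ Y)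

    modal-variables : ∀ {j Z O} {u : Unary n j} {σ χ} →
      VariablesDefined Z O u σ χ → VariablesDefined O [] u σ χ
    modal-variables vars (inj₁ Y∈O) = vars (inj₂ Y∈O)

    mutual
      trᵇ-Defines : ∀ {j s Z O} (φ : Base n s Z O) → NoAlternationPnf ⌊ φ ⌋ᵇ →
        ∀ {u : Unary n j} {σ χ} → VariablesDefined Z O u σ χ →
        Defines (trᵇ φ u) σ (⟦_⟧ᵇ 𝓣 φ χ)
      trᵇ-Defines bot na vars x ρ = mk⇔ (λ ⋠ → ⊥-elim (⋠ (lift ≼-refl))) (λ ())
      trᵇ-Defines top na vars x ρ = mk⇔ (λ _ → lift tt) (λ _ → lift ≼-refl)
      trᵇ-Defines (atom a) na vars x ρ = ⇔-id _
      trᵇ-Defines (neg φ) na vars x ρ =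
        ¬-cong-⇔ (trᵇ-Defines φ (NoAlternationPnf-◂ (neg {φ = φ}) na) vars x ρ)
      trᵇ-Defines (φ and ψ) na vars x ρ =
        trᵇ-Defines φ (NoAlternationPnf-◂ andˡ na) vars x ρ ×-⇔
        trᵇ-Defines ψ (NoAlternationPnf-◂ andʳ na) vars x ρ
      trᵇ-Defines (φ or ψ) na {χ = χ} vars x ρ = mk⇔
        (λ either → case em {ρ x ∈ ⟦_⟧ᵇ 𝓣 φ χ} of λ
          { (yes x∈φ) → inj₁ x∈φ
          ; (no x∉φ)  → inj₂ (Equivalence.to ψ⇔
              (Equivalence.to ¬×¬⇔→ either (x∉φ ∘ Equivalence.to φ⇔))) })
        (λ { (inj₁ x∈φ) (¬φ , _) → ¬φ (Equivalence.from φ⇔ x∈φ)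
           ; (inj₂ x∈ψ) (_ , ¬ψ) → ¬ψ (Equivalence.from ψ⇔ x∈ψ) })
        where
        φ⇔ = trᵇ-Defines φ (NoAlternationPnf-◂ orˡ na) vars x ρ
        ψ⇔ = trᵇ-Defines ψ (NoAlternationPnf-◂ orʳ na) vars x ρ
      trᵇ-Defines (◇≥ k φ) na {u} {σ} {χ} vars x ρ =
        Sat-count k x _ (post (ρ x) ∩ ⟦_⟧ᵇ 𝓣 φ χ) λ f y ρ′ ρ′∘f≗ →
        subst (λ w → _ ⇔ post w (ρ′ y)) (ρ′∘f≗ x) (Sat-child {ρ = ρ′} {σ} (f x) y) ×-⇔
        trᵇ-Defines φ (NoAlternationPnf-◂ ◇≥ na) (modal-variables {u = u} {σ} {χ} vars) y ρ′
      trᵇ-Defines (□< k φ) na {u} {σ} {χ} vars x ρ = ¬-cong-⇔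
        (Sat-count k x _ (post (ρ x) ∖ ⟦_⟧ᵇ 𝓣 φ χ) λ f y ρ′ ρ′∘f≗ →
        subst (λ w → _ ⇔ post w (ρ′ y)) (ρ′∘f≗ x) (Sat-child {ρ = ρ′} {σ} (f x) y) ×-⇔
        ¬-cong-⇔ (trᵇ-Defines φ (NoAlternationPnf-◂ □< na)
                    (modal-variables {u = u} {σ} {χ} vars) y ρ′))
      trᵇ-Defines (var X X∈Z) na vars x ρ = vars (inj₁ X∈Z) x ρ
      trᵇ-Defines (emb ϑ) na vars x ρ = trᶠ-Defines ϑ (NoAlternationPnf-◂ emb na) x ρ

      trBody-Defines : ∀ {j Z O} (ϑ : Fix n Z O) → NoAlternationPnf ⌊ ϑ ⌋ᶠ →
        ∀ {u : Unary n j} {σ χ V} → VariablesDefined Z O u σ χ → Defines₀ u σ V →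
        Defines (trBody ϑ u) σ (blockOperator ϑ χ V)
      trBody-Defines (fix η X ϑ) na {u} {σ} {χ} {V} vars u⇔V =
        trBody-Defines ϑ (NoAlternationPnf-◂ fix na) {u} {σ} {χ ⟨ X ↦ V ⟩} {V} vars′ u⇔V
        where
        vars′ : VariablesDefined (X ∷ _) (X ∷ _) u σ (χ ⟨ X ↦ V ⟩)
        vars′ {Y} Y∈ with Y ≟ X
        ... | yes _  = u⇔V
        ... | no Y≢X = vars (map (≢⇒∈-tail Y≢X) (≢⇒∈-tail Y≢X) Y∈)
      trBody-Defines (base φ) na vars _ = trᵇ-Defines φ (NoAlternationPnf-◂ (base {φ = φ}) na) vars

      -- By uniformity the block is a single fixpoint of F, and F is local as a sentence has no
      -- outer variables. So certificates apply, to F for `μ` and to its dual for `ν`.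
      trᶠ-Defines : ∀ {j} (ϑ : Fix n [] []) → NoAlternationPnf ⌊ ϑ ⌋ᶠ →
        ∀ {σ : Vector (FiniteSubtree nodes) j} {χ} → Defines (trᶠ ϑ) σ (⟦_⟧ᶠ 𝓣 ϑ χ)
      trᶠ-Defines ϑ na {σ} {χ} = block-Defines (lastOp μ ϑ) (uniform-lastOp ϑ na)
        where
        F : Pred Node 0ℓ → Pred Node (lsuc 0ℓ)
        F = blockOperator ϑ χ

        F-local : LocallyMonotone F
        F-local = blockOperator-local ϑ λ _ → (λ ()) , λ ()

        body-Defines : ∀ {j} (u : Unary n j) σ V → Defines₀ u σ V → Defines (trBody ϑ u) σ (F V)
        body-Defines u σ V = trBody-Defines ϑ na {u} {σ} {χ} {V} λ { (inj₁ ()) ; (inj₂ ()) }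

        block-Defines : ∀ η → Uniform η ϑ → Defines (block η (trBody ϑ)) σ (⟦_⟧ᶠ 𝓣 ϑ χ)
        block-Defines μ uni x ρ = ⇔-sym (block-Fixpoint ϑ χ uni) ⇔-∘ (certified⇔μ F-local ⇔-∘
          certified-Defines (trBody ϑ difference) σ F
            (λ Y X → body-Defines difference (X ▹ (Y ▹ σ)) (Y ∖ᵗ X)
              (difference-Defines {σ = σ} Y X)) x ρ)
        block-Defines ν uni x ρ =
          ⇔-sym (block-Fixpoint ϑ χ uni) ⇔-∘ (⇔-sym (Fixpoint-ν⇔¬μ F-mono) ⇔-∘
          ¬-cong-⇔ (certified⇔μ ∁F∁-local ⇔-∘
            certified-Defines (not (trBody ϑ (not difference))) σ (λ W → ∁ (F (∁ W)))
              (λ Y X z ρ′ → ¬-cong-⇔ (body-Defines (not difference) (X ▹ (Y ▹ σ)) (∁ (Y ∖ᵗ X))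
                (not-Defines₀ difference (X ▹ (Y ▹ σ)) (Y ∖ᵗ X)
                  (difference-Defines {σ = σ} Y X)) z ρ′)) x ρ))
          where
          F-mono : ∀ {U V} → U ⊆ V → F U ⊆ F V
          F-mono U⊆V = F-local U⊆V (λ _ → U⊆V)
          ∁F∁-local : LocallyMonotone (λ W → ∁ (F (∁ W)))
          ∁F∁-local here≤ below≤ w∉ w∈ =
            w∉ (F-local (λ ∉V → ∉V ∘ here≤) (λ w→v ∉V → ∉V ∘ below≤ w→v) w∈)

    sentence-correct : (ϑ : Fix n [] []) → NoAlternationPnf ⌊ ϑ ⌋ᶠ → (𝓣 ⊨ᵍ ϑ) ⇔ (𝓣 ⊨ʷ sentence ϑ)
    sentence-correct ϑ na = mk⇔
      (λ ⊨ϑ → rootNode , Equivalence.from ¬∃¬⇔∀ (λ v → lift (root≼ v)) ,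
        Equivalence.from (trᶠ-Defines ϑ na zero _) ⊨ϑ)
      (λ (r , isRoot , ⊨ϑ) → subst (λ w → w ∈ ⟦_⟧ᶠ 𝓣 ϑ (λ _ → ∅))
        (value-injective (≼-antisym (lower (Equivalence.to ¬∃¬⇔∀ isRoot rootNode)) (root≼ r)))
        (Equivalence.to (trᶠ-Defines ϑ na zero _) ⊨ϑ))
      where
      root≼ : ∀ v → value rootNode ≼ value v
      root≼ v = KripkeTree.rooted 𝓣 (value∈nodes v)

theorem13 : ExcludedMiddle (lsuc 0ℓ) →
    ∀ (n : ℕ) (ϑ : OSGMCSentence n) → AlternationFree ϑ →
    ∃ λ (φ : WMTLSentence n) →
    ∀ (𝓣 : KripkeTree n) → FinitelyBranching 𝓣 → (𝓣 ⊨ᵍ ϑ) ⇔ (𝓣 ⊨ʷ φ)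
theorem13 em n ϑ af = sentence ϑ , λ 𝓣 finitelyBranching →
  -- `AlternationFree` unfolds to `NoAlternation` of the normal form at sign `+`.
  Classical.OnTree.sentence-correct em 𝓣 finitelyBranching ϑ (+ , af)
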